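{- For all $n\ge1$ and $1\le m\le n$, the numbers of permutations of $[n]$ with $m$ cycles that cyclically avoid 3--1--2, that cyclically avoid 2--3--1, and that cyclically avoid 2--1--3 are all equal to the number of Dyck paths of semilength $n$ with $m$ returns to the $x$-axis, namely \[\frac{m}{2n-m}\binom{2n-m}{n}.\]
   Context: The standard cycle form writes each cycle starting with its smallest element, cycles listed in decreasing order of smallest elements; $\Psi(\pi)$ is the word obtained by deleting the parentheses. $\pi$ cyclically avoids the classical pattern $\sigma$ if the word $\Psi(\pi)$ has no indices $i<j<k$ with $\Psi(\pi)_i\Psi(\pi)_j\Psi(\pi)_k$ order-isomorphic to $\sigma$. A Dyck path of semilength $n$ is a lattice path from $(0,0)$ to $(2n,0)$ with steps $(1,1)$, $(1,-1)$ never going below the $x$-axis; a return is any visit to the $x$-axis other than the starting point. -}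

module Defs where

open import Data.Bool using (Bool; true; false; _∧_; _∨_; not; if_then_else_)
open import Data.Nat using (ℕ; zero; suc; _+_; _*_; _∸_; _≡ᵇ_; _<ᵇ_; _≤ᵇ_)
open import Data.Fin using (Fin; toℕ)
open import Data.List using (List; []; _∷_; _++_; map; concatMap; length; filterᵇ; allFin; reverse)
open import Data.Bool.ListAction using (and; or)
open import Data.Vec using (Vec; lookup; toList)
import Data.Vec as V
open import Data.Product using (_×_; _,_)

_⇔ᵇ_ : Bool → Bool → Bool
true  ⇔ᵇ b = b
false ⇔ᵇ b = not b

allWords : {A : Set} → List A → (k : ℕ) → List (Vec A k)
allWords as zero    = V.[] ∷ []
allWords as (suc k) = concatMap (λ a → map (a V.∷_) (allWords as k)) as

-- Permutations of [n] in one-line notation: π i = lookup π i.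
-- (We use 0-based [n] = {0,…,n-1}; order-isomorphism is unaffected.)

allDistinct : List ℕ → Bool
allDistinct []       = true
allDistinct (x ∷ xs) = and (map (λ y → not (x ≡ᵇ y)) xs) ∧ allDistinct xs

isPerm : {n : ℕ} → Vec (Fin n) n → Bool
isPerm π = allDistinct (map toℕ (toList π))

allPerms : (n : ℕ) → List (Vec (Fin n) n)
allPerms n = filterᵇ isPerm (allWords (allFin n) n)

module _ {n : ℕ} (π : Vec (Fin n) n) where

  app : Fin n → Fin n
  app i = lookup π i

  -- π(x), π²(x), … until returning to i (fuel n suffices)
  orbitFrom : Fin n → ℕ → Fin n → List ℕ
  orbitFrom i zero    x = []
  orbitFrom i (suc f) x =
    if toℕ x ≡ᵇ toℕ i then [] else toℕ x ∷ orbitFrom i f (app x)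

  cycleOf : Fin n → List ℕ
  cycleOf i = toℕ i ∷ orbitFrom i n (app i)

  isCycleMin : Fin n → Bool
  isCycleMin i = and (map (λ y → toℕ i ≤ᵇ y) (cycleOf i))

  cycleMins : List (Fin n)
  cycleMins = filterᵇ isCycleMin (reverse (allFin n))

  numCycles : ℕ
  numCycles = length cycleMins

  -- Ψ(π): standard cycle form with parentheses erased
  Ψ : List ℕ
  Ψ = concatMap cycleOf cycleMins

Pattern3 : Set
Pattern3 = ℕ × ℕ × ℕ

p312 p231 p213 : Pattern3
p312 = 3 , 1 , 2
p231 = 2 , 3 , 1
p213 = 2 , 1 , 3

orderIso : Pattern3 → ℕ → ℕ → ℕ → Bool
orderIso (a , b , c) x y z =
  ((a <ᵇ b) ⇔ᵇ (x <ᵇ y)) ∧ ((a <ᵇ c) ⇔ᵇ (x <ᵇ z)) ∧ ((b <ᵇ c) ⇔ᵇ (y <ᵇ z))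
  ∧ ((b <ᵇ a) ⇔ᵇ (y <ᵇ x)) ∧ ((c <ᵇ a) ⇔ᵇ (z <ᵇ x)) ∧ ((c <ᵇ b) ⇔ᵇ (z <ᵇ y))

pairs : List ℕ → List (ℕ × ℕ)
pairs []       = []
pairs (y ∷ ys) = map (y ,_) ys ++ pairs ys

containsᵇ : Pattern3 → List ℕ → Bool
containsᵇ σ []       = false
containsᵇ σ (x ∷ xs) =
  or (map (λ { (y , z) → orderIso σ x y z }) (pairs xs)) ∨ containsᵇ σ xs

cyclicallyAvoids : {n : ℕ} → Pattern3 → Vec (Fin n) n → Bool
cyclicallyAvoids σ π = not (containsᵇ σ (Ψ π))

countCycAvoid : Pattern3 → (n m : ℕ) → ℕ
countCycAvoid σ n m =
  length (filterᵇ (λ π → cyclicallyAvoids σ π ∧ (numCycles π ≡ᵇ m)) (allPerms n))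

-- Dyck paths: words over {U = true, D = false}.

-- Heights after each step, starting from height h; Nothing-free encoding:
-- returns (valid so far, list of heights after each step).
-- A step D at height 0 makes the path invalid.
walk : ℕ → List Bool → Bool × List ℕ
walk h []           = true , []
walk h (true ∷ s)   with walk (suc h) s
... | ok , hs = ok , (suc h ∷ hs)
walk zero (false ∷ s) = false , []
walk (suc h) (false ∷ s) with walk h s
... | ok , hs = ok , (h ∷ hs)

finalHeight : ℕ → List Bool → ℕ
finalHeight h []          = h
finalHeight h (true ∷ s)  = finalHeight (suc h) s
finalHeight h (false ∷ s) = finalHeight (h ∸ 1) s

isDyck : List Bool → Bool
isDyck s with walk 0 s
... | ok , _ = ok ∧ (finalHeight 0 s ≡ᵇ 0)

-- returns: visits to the x-axis other than the start
returns : List Bool → ℕ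
returns s with walk 0 s
... | _ , hs = length (filterᵇ (λ h → h ≡ᵇ 0) hs)

countDyck : (n m : ℕ) → ℕ
countDyck n m =
  length (filterᵇ (λ w → isDyck (toList w) ∧ (returns (toList w) ≡ᵇ m))
                  (allWords (true ∷ false ∷ []) (2 * n)))

{-# OPTIONS --safe #-}
module Submission where

-- Erasing parentheses is an injective self-map of the words of permutations of [n], and the cycles of π
-- begin at the left-to-right minima of Ψ(π). So one counts words avoiding σ by left-to-right minima.
-- These words grow in a generating tree where a word with k minima has exactly one child with j minima
-- for each j = 1, …, k + 1:
--   3–1–2: prepend any letter v ≤ k, letters starting at 0 (here the number of minima is the first letter plus one);
--   2–1–3: prepend n or one of the minima of the word;
--   2–3–1: insert a new smallest letter into the initial decreasing run, which consists of the minima.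
-- Hence the counts satisfy a(n+1, m+1) = a(n, m) + a(n+1, m+2), the recurrence for Dyck paths by returns;
-- its solution is a difference of two binomial coefficients.

open import Defs
open import Data.Bool using (Bool; true; false; _∧_; _∨_; T; not; if_then_else_)
open import Data.Bool.ListAction using (and; or)
open import Data.Bool.Properties using (T?; T-∧; ∧-zeroʳ)
open import Data.Empty using (⊥-elim)
open import Data.Fin using (Fin; zero; suc; toℕ; fromℕ<)
open import Data.Fin.Properties using (toℕ-injective; toℕ<n; toℕ-fromℕ<; pigeonhole)
open import Data.List using (List; []; _∷_; _++_; map; length; filterᵇ; concatMap; downFrom; upTo; allFin; reverse)
open import Data.List.Membership.Propositional using (_∈_; _∉_; find; lose)
open import Data.List.Membership.Propositional.Properties using (∈-∃++; ∈-map⁺; ∈-map⁻; ∈-concatMap⁺; ∈-concatMap⁻; ∈-filter⁺; ∈-filter⁻; ∈-upTo⁺; ∈-upTo⁻; ∈-downFrom⁺; ∈-downFrom⁻; ∈-allFin)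
open import Data.List.Properties using (length-++; filter-++; length-map; length-upTo; length-tabulate; ∷-injective; map-++; map-∘; map-injective; map-cong-local; ++-identityʳ; unfold-reverse)
open import Data.List.Relation.Binary.Disjoint.Propositional using (Disjoint)
open import Data.List.Relation.Binary.Permutation.Propositional as Perm using (_↭_; ↭-trans; ↭-refl; ↭-prep; ↭-reflexive)
import Data.List.Relation.Binary.Permutation.Propositional.Properties as Perm
open import Data.List.Relation.Binary.Permutation.Propositional.Properties using (∈-resp-↭; ↭-length; filter-↭; shift; shifts)
open import Data.List.Relation.Binary.Subset.Propositional using (_⊆_)
open import Data.List.Relation.Unary.All as All using (All; []; _∷_)
import Data.List.Relation.Unary.All.Properties as All
open import Data.List.Relation.Unary.AllPairs as AllPairs using (AllPairs; []; _∷_)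
import Data.List.Relation.Unary.AllPairs.Properties as AllPairs
open import Data.List.Relation.Unary.Any using (here; there)
import Data.List.Relation.Unary.Any.Properties as Any
open import Data.List.Relation.Unary.Unique.Propositional using (Unique)
import Data.List.Relation.Unary.Unique.Propositional.Properties as Unique
open import Data.Nat
open import Data.Nat.Combinatorics using (_C_; nCn≡1; nC1≡n; nCk≡nC[n∸k]; nCk+nC[k+1]≡[n+1]C[k+1])
open import Data.Nat.GeneralisedArithmetic using (iterate)
open import Data.Nat.Properties
open import Data.Nat.Tactic.RingSolver using (solve-∀)
open import Data.Product using (_×_; _,_; proj₁; proj₂; ∃; ∃₂)
open import Data.Sum using (_⊎_; inj₁; inj₂)
open import Data.Vec using (Vec; toList; lookup)
import Data.Vec as V
open import Data.Vec.Membership.Propositional.Properties using (∈-toList⁺) renaming (∈-lookup to lookup-∈)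
import Data.Vec.Properties as V
open import Function using (_∘_; Equivalence)
open import Relation.Binary.Definitions using (tri<; tri≈; tri>)
open import Relation.Binary.PropositionalEquality using (_≡_; _≢_; refl; sym; trans; cong; cong₂; subst; module ≡-Reasoning)
open import Relation.Nullary using (¬_; yes; no; contradiction)
open ≡-Reasoning

-- A word with m + 1 minima arises from exactly one parent, and a parent has such a child precisely
-- when it has at least m minima. Parents with exactly m give the first term of the recurrence;
-- those with at least m + 1 are counted by their children with m + 2 minima. For the Catalan series
-- C this is C^p = C^(p-1) + x C^(p+1), that is, C = 1 + x C^2 multiplied by C^(p-1), where p is the
-- number of minima and x marks n - p.
--
-- In each tree only occurrences of the pattern through the new letter have to be excluded, since
-- the old letters keep their relative order. A prepended letter can only be the first letter of an
-- occurrence, and a new smallest letter only the last letter of 2-3-1. Admissibility thus becomes a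
-- condition on pairs of old letters.
--
-- The class of Dyck paths is not closed under removing the first step, so paths are counted from
-- every starting height. Binomial identities are stated additively or multiplied out, because
-- subtraction on ℕ truncates.

private variable
  A B : Set
  n : ℕ

count : (A → Bool) → List A → ℕ
count p xs = length (filterᵇ p xs)

count-++ : (p : A → Bool) (xs ys : List A) → count p (xs ++ ys) ≡ count p xs + count p ys
count-++ p xs ys = trans (cong length (filter-++ (T? ∘ p) xs ys)) (length-++ (filterᵇ p xs))

count-map : (p : B → Bool) (f : A → B) (xs : List A) → count p (map f xs) ≡ count (p ∘ f) xs
count-map p f [] = refl
count-map p f (x ∷ xs) with p (f x)
... | true = cong suc (count-map p f xs)
... | false = count-map p f xs

count-cong-∈ : {p q : A → Bool} (xs : List A) → (∀ {x} → x ∈ xs → p x ≡ q x) → count p xs ≡ count q xs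
count-cong-∈ [] _ = refl
count-cong-∈ {p = p} {q} (x ∷ xs) h with p x | q x | h (here refl)
... | true  | .true  | refl = cong suc (count-cong-∈ xs (h ∘ there))
... | false | .false | refl = count-cong-∈ xs (h ∘ there)

count-false : {p : A → Bool} → (∀ x → p x ≡ false) → (xs : List A) → count p xs ≡ 0
count-false p≗f [] = refl
count-false {p = p} p≗f (x ∷ xs) rewrite p≗f x = count-false p≗f xs

-- Ballot numbers and Dyck paths

-- ballot p i is the coefficient of xⁱ in the p-th power of the Catalan series.
ballot : ℕ → ℕ → ℕ
ballot zero    zero    = 1
ballot zero    (suc i) = 0
ballot (suc p) zero    = 1
ballot (suc p) (suc i) = ballot p (suc i) + ballot (suc (suc p)) i

ballot-0 : ∀ p → ballot p 0 ≡ 1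
ballot-0 zero    = refl
ballot-0 (suc p) = refl

-- n C (k − 1), with value 0 at k = 0
_C⁻_ : ℕ → ℕ → ℕ
n C⁻ zero  = 0
n C⁻ suc k = n C k

nC0≡1 : ∀ n → n C 0 ≡ 1
nC0≡1 n = trans (nCk≡nC[n∸k] {0} {n} z≤n) (nCn≡1 n)

C⁻-pascal : ∀ n k → suc n C k ≡ n C⁻ k + n C k
C⁻-pascal n zero    = trans (nC0≡1 (suc n)) (sym (nC0≡1 n))
C⁻-pascal n (suc k) = sym (nCk+nC[k+1]≡[n+1]C[k+1] n k)

C-symm : ∀ a b → (a + b) C a ≡ (a + b) C b
C-symm a b = trans (nCk≡nC[n∸k] (m≤m+n a b)) (cong ((a + b) C_) (m+n∸m≡n a b))

-- Both summands of `ballot (suc p) (suc i)` are governed by row M of Pascal's triangle; two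
-- applications of Pascal's rule move to row M + 1.
ballot-C-step : ∀ p i → let M = i + suc i + p in
  ballot p (suc i) + M C i ≡ M C suc i → ballot (2 + p) i + M C⁻ i ≡ M C i →
  ballot (suc p) (suc i) + suc M C i ≡ suc M C suc i
ballot-C-step p i left right = begin
  ballot p (suc i) + ballot (2 + p) i + suc M C i
    ≡⟨ cong (ballot p (suc i) + ballot (2 + p) i +_) (C⁻-pascal M i) ⟩
  ballot p (suc i) + ballot (2 + p) i + (M C⁻ i + M C i)
    ≡⟨ swap-mid (ballot p (suc i)) _ _ _ ⟩
  ballot p (suc i) + M C i + (ballot (2 + p) i + M C⁻ i)
    ≡⟨ cong₂ _+_ left right ⟩
  M C suc i + M C i
    ≡⟨ +-comm (M C suc i) (M C i) ⟩
  M C i + M C suc i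
    ≡⟨ nCk+nC[k+1]≡[n+1]C[k+1] M i ⟩
  suc M C suc i ∎
  where
  M : ℕ
  M = i + suc i + p
  swap-mid : ∀ a b c d → a + b + (c + d) ≡ a + d + (b + c)
  swap-mid = solve-∀

-- The reflection-principle difference of neighbouring binomials in row 2i + p. The induction
-- follows the recursion of `ballot`; where p = 0 the left summand is 0 and the two middle entries
-- of row 2i + 1 agree.
ballot-C : ∀ p i → ballot (suc p) i + (i + i + p) C⁻ i ≡ (i + i + p) C i
ballot-C p       zero    = sym (nC0≡1 p)
ballot-C zero    (suc i) = ballot-C-step 0 i
  (subst (λ k → k C i ≡ k C suc i) (sym (+-identityʳ (i + suc i))) (C-symm i (suc i)))
  (subst (λ k → ballot 2 i + k C⁻ i ≡ k C i) (eq i) (ballot-C 1 i))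
  where
  eq : ∀ i → i + i + 1 ≡ i + suc i + 0
  eq = solve-∀
ballot-C (suc p) (suc i) = ballot-C-step (suc p) i
  (subst (λ k → ballot (suc p) (suc i) + k C i ≡ k C suc i) (eq₁ i p) (ballot-C p (suc i)))
  (subst (λ k → ballot (3 + p) i + k C⁻ i ≡ k C i) (eq₂ i p) (ballot-C (2 + p) i))
  where
  eq₁ : ∀ i p → suc i + suc i + p ≡ i + suc i + suc p
  eq₁ = solve-∀
  eq₂ : ∀ i p → i + i + (2 + p) ≡ i + suc i + suc p
  eq₂ = solve-∀

-- The factorial-free form of k C(n, k) = (n - k + 1) C(n, k - 1). After Pascal's rule the weight i
-- + j + 3 of the common binomial is split as (2 + i) + (1 + j) for one induction hypothesis and as
-- (1 + i) + (2 + j) for the other.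
C-absorb : ∀ i j → suc i * ((suc i + j) C suc i) ≡ suc j * ((suc i + j) C i)
C-absorb zero j = begin
  1 * (suc j C 1)   ≡⟨ cong (1 *_) (nC1≡n (suc j)) ⟩
  1 * suc j         ≡⟨ *-comm 1 (suc j) ⟩
  suc j * 1         ≡⟨ cong (suc j *_) (nC0≡1 (suc j)) ⟨
  suc j * (suc j C 0) ∎
C-absorb (suc i) zero = begin
  (2 + i) * ((2 + i + 0) C (2 + i))  ≡⟨ cong (λ k → (2 + i) * (k C (2 + i))) (+-identityʳ (2 + i)) ⟩
  (2 + i) * ((2 + i) C (2 + i))      ≡⟨ cong ((2 + i) *_) (nCn≡1 (2 + i)) ⟩
  (2 + i) * 1                        ≡⟨ *-comm (2 + i) 1 ⟩
  1 * (2 + i)                        ≡⟨ cong (1 *_) (nC1≡n (2 + i)) ⟨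
  1 * ((2 + i) C 1)                  ≡⟨ cong (λ k → 1 * (k C 1)) (+-comm 1 (suc i)) ⟩
  1 * ((suc i + 1) C 1)              ≡⟨ cong (1 *_) (C-symm (suc i) 1) ⟨
  1 * ((suc i + 1) C suc i)          ≡⟨ cong (λ k → 1 * (k C suc i)) (trans (+-comm (suc i) 1) (sym (+-identityʳ (2 + i)))) ⟩
  1 * ((2 + i + 0) C suc i)          ∎
C-absorb (suc i) (suc j) = begin
  (2 + i) * (suc N C (2 + i))
    ≡⟨ cong ((2 + i) *_) (sym (nCk+nC[k+1]≡[n+1]C[k+1] N (suc i))) ⟩
  (2 + i) * (N C suc i + N C (2 + i))
    ≡⟨ *-distribˡ-+ (2 + i) (N C suc i) _ ⟩
  (2 + i) * (N C suc i) + (2 + i) * (N C (2 + i))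
    ≡⟨ cong ((2 + i) * (N C suc i) +_) ih₁ ⟩
  (2 + i) * (N C suc i) + suc j * (N C suc i)
    ≡⟨ regroup i j (N C suc i) ⟩
  suc i * (N C suc i) + (2 + j) * (N C suc i)
    ≡⟨ cong (_+ (2 + j) * (N C suc i)) (C-absorb i (suc j)) ⟩
  (2 + j) * (N C i) + (2 + j) * (N C suc i)
    ≡⟨ *-distribˡ-+ (2 + j) (N C i) _ ⟨
  (2 + j) * (N C i + N C suc i)
    ≡⟨ cong ((2 + j) *_) (nCk+nC[k+1]≡[n+1]C[k+1] N i) ⟩
  (2 + j) * (suc N C suc i) ∎
  where
  N : ℕ
  N = suc i + suc j
  ih₁ : (2 + i) * (N C (2 + i)) ≡ suc j * (N C suc i)
  ih₁ = subst (λ k → (2 + i) * (k C (2 + i)) ≡ suc j * (k C suc i)) (sym (+-suc (suc i) j)) (C-absorb (suc i) j)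
  regroup : ∀ i j a → (2 + i) * a + suc j * a ≡ suc i * a + (2 + j) * a
  regroup = solve-∀

C⁻-absorb : ∀ i p → i * ((i + i + p) C i) ≡ (i + suc p) * ((i + i + p) C⁻ i)
C⁻-absorb zero    p = sym (*-zeroʳ (suc p))
C⁻-absorb (suc i) p =
  subst (λ k → suc i * (k C suc i) ≡ (suc i + suc p) * (k C i)) (sym (+-assoc (suc i) (suc i) p))
    (trans (C-absorb i (suc i + p)) (cong (_* ((suc i + (suc i + p)) C i)) (sym (+-suc (suc i) p))))

-- Absorption turns x + y = K C i into i x = (p + 1) y. Substituted for the two copies of i x, this
-- leaves (p + 1)(y + (x + y)), one Pascal step from the claim.
ballot-closed : ∀ p i → (i + i + suc p) * ballot (suc p) i ≡ suc p * ((i + i + suc p) C (suc p + i))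
ballot-closed p i = begin
  (i + i + suc p) * x               ≡⟨ e₁ i p x ⟩
  i * x + i * x + suc p * x         ≡⟨ cong (λ t → t + t + suc p * x) ix≡ ⟩
  suc p * y + suc p * y + suc p * x ≡⟨ e₂ p x y ⟩
  suc p * (y + (x + y))             ≡⟨ cong (λ t → suc p * (y + t)) (ballot-C p i) ⟩
  suc p * (K C⁻ i + K C i)          ≡⟨ cong (suc p *_) (C⁻-pascal K i) ⟨
  suc p * (suc K C i)               ≡⟨ cong (λ k → suc p * (k C i)) (sym (e₃ i p)) ⟩
  suc p * ((i + (suc p + i)) C i)   ≡⟨ cong (suc p *_) (C-symm i (suc p + i)) ⟩
  suc p * ((i + (suc p + i)) C (suc p + i)) ≡⟨ cong (λ k → suc p * (k C (suc p + i))) (e₄ i p) ⟩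
  suc p * ((i + i + suc p) C (suc p + i)) ∎
  where
  K x y : ℕ
  K = i + i + p
  x = ballot (suc p) i
  y = K C⁻ i
  e₁ : ∀ i p x → (i + i + suc p) * x ≡ i * x + i * x + suc p * x
  e₁ = solve-∀
  e₂ : ∀ p x y → suc p * y + suc p * y + suc p * x ≡ suc p * (y + (x + y))
  e₂ = solve-∀
  e₃ : ∀ i p → i + (suc p + i) ≡ suc (i + i + p)
  e₃ = solve-∀
  e₄ : ∀ i p → i + (suc p + i) ≡ i + i + suc p
  e₄ = solve-∀
  ix≡ : i * x ≡ suc p * y
  ix≡ = +-cancelʳ-≡ (i * y) (i * x) (suc p * y) (begin
    i * x + i * y     ≡⟨ *-distribˡ-+ i x y ⟨
    i * (x + y)       ≡⟨ cong (i *_) (ballot-C p i) ⟩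
    i * (K C i)       ≡⟨ C⁻-absorb i p ⟩
    (i + suc p) * y   ≡⟨ *-distribʳ-+ y i (suc p) ⟩
    i * y + suc p * y ≡⟨ +-comm (i * y) _ ⟩
    suc p * y + i * y ∎)

-- The test inside `countDyck` for paths that start at height h; at h = 0 the two agree
-- definitionally.
descends : ℕ → ℕ → List Bool → Bool
descends h r s = (proj₁ (walk h s) ∧ (finalHeight h s ≡ᵇ 0)) ∧ (count (_≡ᵇ 0) (proj₂ (walk h s)) ≡ᵇ r)

#paths : ℕ → ℕ → ℕ → ℕ
#paths h ℓ r = count (λ w → descends h r (toList w)) (allWords (true ∷ false ∷ []) ℓ)

#paths-suc : ∀ h ℓ r → #paths h (suc ℓ) r ≡
  #paths (suc h) ℓ r + count (λ w → descends h r (false ∷ toList w)) (allWords (true ∷ false ∷ []) ℓ)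
#paths-suc h ℓ r = begin
  count P (map (true V.∷_) ws ++ (map (false V.∷_) ws ++ []))
    ≡⟨ cong (λ l → count P (map (true V.∷_) ws ++ l)) (++-identityʳ _) ⟩
  count P (map (true V.∷_) ws ++ map (false V.∷_) ws)
    ≡⟨ count-++ P (map (true V.∷_) ws) _ ⟩
  count P (map (true V.∷_) ws) + count P (map (false V.∷_) ws)
    ≡⟨ cong₂ _+_ (count-map P (true V.∷_) ws) (count-map P (false V.∷_) ws) ⟩
  #paths (suc h) ℓ r + count (λ w → descends h r (false ∷ toList w)) ws ∎
  where
  ws = allWords (true ∷ false ∷ []) ℓ
  P : V.Vec Bool (suc ℓ) → Bool
  P w = descends h r (toList w)

#paths-ground : ∀ ℓ r → #paths 0 (suc ℓ) r ≡ #paths 1 ℓ r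
#paths-ground ℓ r = begin
  #paths 0 (suc ℓ) r  ≡⟨ #paths-suc 0 ℓ r ⟩
  #paths 1 ℓ r + _    ≡⟨ cong (#paths 1 ℓ r +_) (count-false (λ _ → refl) (allWords _ ℓ)) ⟩
  #paths 1 ℓ r + 0    ≡⟨ +-identityʳ _ ⟩
  #paths 1 ℓ r        ∎

#paths-one : ∀ ℓ r → #paths 1 (suc ℓ) (suc r) ≡ #paths 2 ℓ (suc r) + #paths 0 ℓ r
#paths-one ℓ r = #paths-suc 1 ℓ (suc r)

#paths-high : ∀ h ℓ r → #paths (2 + h) (suc ℓ) r ≡ #paths (3 + h) ℓ r + #paths (suc h) ℓ r
#paths-high h ℓ r = #paths-suc (2 + h) ℓ r

#paths-no-return : ∀ h ℓ → #paths (suc h) ℓ 0 ≡ 0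
#paths-no-return h zero = refl
#paths-no-return zero (suc ℓ) = begin
  #paths 1 (suc ℓ) 0  ≡⟨ #paths-suc 1 ℓ 0 ⟩
  #paths 2 ℓ 0 + _    ≡⟨ cong₂ _+_ (#paths-no-return 1 ℓ) (count-false (λ w → ∧-zeroʳ _) (allWords _ ℓ)) ⟩
  0                   ∎
#paths-no-return (suc h) (suc ℓ) =
  trans (#paths-high h ℓ 0) (cong₂ _+_ (#paths-no-return (2 + h) ℓ) (#paths-no-return h ℓ))

-- Reaching the axis from height h + 1 takes at least h + 1 steps, and every further return at least
-- two. This removes the up-step branch when a path has minimal length.
#paths-short₀ : ∀ ℓ r → ℓ < r + r → #paths 0 ℓ r ≡ 0
#paths-short₊ : ∀ ℓ h r → ℓ < suc (h + (r + r)) → #paths (suc h) ℓ (suc r) ≡ 0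

#paths-short₀ zero    (suc r) _  = refl
#paths-short₀ (suc ℓ) (suc r) lt =
  trans (#paths-ground ℓ (suc r)) (#paths-short₊ ℓ 0 r (s≤s⁻¹ (≤-trans lt (≤-reflexive (cong suc (+-suc r r))))))
#paths-short₊ zero    h       r _  = refl
#paths-short₊ (suc ℓ) zero    r lt = trans (#paths-one ℓ r)
  (cong₂ _+_ (#paths-short₊ ℓ 1 r (m≤n⇒m≤1+n (<-trans (n<1+n ℓ) lt))) (#paths-short₀ ℓ r (s≤s⁻¹ lt)))
#paths-short₊ (suc ℓ) (suc h) r lt = trans (#paths-high h ℓ (suc r))
  (cong₂ _+_ (#paths-short₊ ℓ (2 + h) r (m≤n⇒m≤1+n (<-trans (n<1+n ℓ) lt)))
             (#paths-short₊ ℓ h r (s≤s⁻¹ lt)))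

-- Cutting a path at its first visits to lower levels and at its returns gives one Catalan factor
-- for each of the h + 1 levels descended and for each of the r further returns, hence the exponent
-- `suc (h + r)`. The length exceeds the minimum by 2i, and an up step from positive height lowers
-- this surplus by two (`#paths-up`).
#paths-ballot₀ : ∀ ℓ r i → ℓ ≡ r + r + (i + i) → #paths 0 ℓ r ≡ ballot r i
#paths-ballot₊ : ∀ ℓ h r i → ℓ ≡ suc (h + (r + r + (i + i))) → #paths (suc h) ℓ (suc r) ≡ ballot (suc (h + r)) i
#paths-up : ∀ ℓ h r i → ℓ ≡ h + (r + r + (suc i + suc i)) → #paths (2 + h) ℓ (suc r) ≡ ballot (2 + (h + r)) i

#paths-ballot₀ zero    zero    zero    eq = refl
#paths-ballot₀ (suc ℓ) zero    (suc i) eq = trans (#paths-ground ℓ 0) (#paths-no-return 0 ℓ)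
#paths-ballot₀ (suc ℓ) (suc r) i       eq =
  trans (#paths-ground ℓ (suc r)) (#paths-ballot₊ ℓ 0 r i (trans (suc-injective eq) (cong (_+ (i + i)) (+-suc r r))))
#paths-ballot₊ (suc ℓ) zero r zero eq = trans (#paths-one ℓ r) (trans
  (cong₂ _+_ (#paths-short₊ ℓ 1 r (s≤s (≤-trans (≤-reflexive ℓ≡) (n≤1+n (r + r)))))
             (#paths-ballot₀ ℓ r 0 (suc-injective eq))) (ballot-0 r))
  where
  ℓ≡ : ℓ ≡ r + r
  ℓ≡ = trans (suc-injective eq) (+-identityʳ (r + r))
#paths-ballot₊ (suc ℓ) zero r (suc i) eq = trans (#paths-one ℓ r) (trans
  (cong₂ _+_ (#paths-up ℓ 0 r i (suc-injective eq)) (#paths-ballot₀ ℓ r (suc i) (suc-injective eq)))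
  (+-comm (ballot (2 + r) i) _))
#paths-ballot₊ (suc ℓ) (suc h) r zero eq = trans (#paths-high h ℓ (suc r))
  (cong₂ _+_ (#paths-short₊ ℓ (2 + h) r (s≤s (≤-trans (≤-reflexive ℓ≡) (n≤1+n _))))
             (#paths-ballot₊ ℓ h r 0 (suc-injective eq)))
  where
  ℓ≡ : ℓ ≡ suc (h + (r + r))
  ℓ≡ = trans (suc-injective eq) (cong (λ k → suc (h + k)) (+-identityʳ (r + r)))
#paths-ballot₊ (suc ℓ) (suc h) r (suc i) eq = trans (#paths-high h ℓ (suc r)) (trans
  (cong₂ _+_ (#paths-up ℓ (suc h) r i (suc-injective eq)) (#paths-ballot₊ ℓ h r (suc i) (suc-injective eq)))
  (+-comm (ballot (3 + (h + r)) i) _))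
#paths-up ℓ h r i eq = #paths-ballot₊ ℓ (suc h) r i (trans eq (eq′ h r i))
  where
  eq′ : ∀ h r i → h + (r + r + (suc i + suc i)) ≡ 2 + (h + (r + r + (i + i)))
  eq′ = solve-∀

countDyck≡ballot : ∀ m i → countDyck (m + i) m ≡ ballot m i
countDyck≡ballot m i = #paths-ballot₀ (2 * (m + i)) m i (double m i)
  where
  double : ∀ m i → 2 * (m + i) ≡ m + m + (i + i)
  double = solve-∀

-- Lists without repetition, up to rearrangement

count-↭ : (p : A → Bool) {xs ys : List A} → xs ↭ ys → count p xs ≡ count p ys
count-↭ p xs↭ys = ↭-length (filter-↭ (T? ∘ p) xs↭ys)

unique-⊆⇒↭-++ : {xs ys : List A} → Unique xs → xs ⊆ ys → ∃ λ zs → ys ↭ xs ++ zs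
unique-⊆⇒↭-++ {xs = []} {ys} _ _ = ys , ↭-refl
unique-⊆⇒↭-++ {xs = x ∷ xs} (x∉xs ∷ u) sub with ∈-∃++ (sub (here refl))
... | us , vs , refl = zs , ↭-trans (shift x us vs) (↭-prep x rest)
  where
  sub′ : xs ⊆ us ++ vs
  sub′ {y} y∈xs with ∈-resp-↭ (shift x us vs) (sub (there y∈xs))
  ... | here y≡x = contradiction (sym y≡x) (All.lookup x∉xs y∈xs)
  ... | there y∈ = y∈
  ih = unique-⊆⇒↭-++ u sub′
  zs = proj₁ ih
  rest = proj₂ ih

unique-⊆⇒length-≤ : {xs ys : List A} → Unique xs → xs ⊆ ys → length xs ≤ length ys
unique-⊆⇒length-≤ {xs = xs} u sub with unique-⊆⇒↭-++ u sub
... | zs , ys↭ = ≤-trans (m≤m+n _ _) (≤-reflexive (sym (trans (↭-length ys↭) (length-++ xs))))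

unique-⊆-length⇒↭ : {xs ys : List A} → Unique xs → xs ⊆ ys → length ys ≤ length xs → ys ↭ xs
unique-⊆-length⇒↭ {xs = xs} {ys} u sub len with unique-⊆⇒↭-++ u sub
... | [] , ys↭ = subst (ys ↭_) (++-identityʳ xs) ys↭
... | z ∷ zs , ys↭ = contradiction len (<⇒≱ (≤-trans (s≤s (m≤m+n (length xs) (length zs)))
        (≤-reflexive (sym (trans (↭-length ys↭) (trans (length-++ xs) (+-suc _ _)))))))

unique-⇔⇒↭ : {xs ys : List A} → Unique xs → Unique ys → xs ⊆ ys → ys ⊆ xs → ys ↭ xs
unique-⇔⇒↭ ux uy xs⊆ys ys⊆xs = unique-⊆-length⇒↭ ux xs⊆ys (unique-⊆⇒length-≤ uy ys⊆xs)

map-unique : (g : A → B) {xs : List A} → Unique xs → (∀ {x y} → x ∈ xs → y ∈ xs → g x ≡ g y → x ≡ y) → Unique (map g xs)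
map-unique g [] _ = []
map-unique g (x∉xs ∷ u) inj =
  All.map⁺ (All.tabulate (λ y∈ eq → All.lookup x∉xs y∈ (inj (here refl) (there y∈) eq)))
  ∷ map-unique g u (λ p q → inj (there p) (there q))

concatMap-unique : (f : A → List B) {xs : List A} → Unique xs → (∀ {x} → x ∈ xs → Unique (f x)) →
  (∀ {x x′ y} → x ∈ xs → x′ ∈ xs → y ∈ f x → y ∈ f x′ → x ≡ x′) → Unique (concatMap f xs)
concatMap-unique f [] _ _ = []
concatMap-unique f {x ∷ xs} (x∉xs ∷ u) uf inj =
  Unique.++⁺ (uf (here refl)) (concatMap-unique f u (uf ∘ there) (λ p q → inj (there p) (there q))) disjoint
  where
  disjoint : Disjoint (f x) (concatMap f xs)
  disjoint (y∈fx , y∈) with find (∈-concatMap⁻ f {xs = xs} y∈)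
  ... | x′ , x′∈xs , y∈fx′ =
    All.lookup x∉xs x′∈xs (inj (here refl) (there x′∈xs) y∈fx y∈fx′)

-- Words of permutations as lists of natural numbers

record IsPermWord (n : ℕ) (w : List ℕ) : Set where
  constructor permWord
  field
    unique  : Unique w
    bounded : All (_< n) w
    size    : length w ≡ n
open IsPermWord public

-- By the pigeonhole principle, n distinct letters below n are all of them.
permWord-↭ : ∀ {w} → IsPermWord n w → upTo n ↭ w
permWord-↭ {n} pw = unique-⊆-length⇒↭ (unique pw) (λ x∈ → ∈-upTo⁺ (All.lookup (bounded pw) x∈))
  (≤-reflexive (trans (length-upTo n) (sym (size pw))))

permWord-∈ : ∀ {w i} → IsPermWord n w → i < n → i ∈ w
permWord-∈ pw i<n = ∈-resp-↭ (permWord-↭ pw) (∈-upTo⁺ i<n)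

letters : ∀ {k} → Vec (Fin n) k → List ℕ
letters v = map toℕ (toList v)

letters-injective : ∀ {k} (v v′ : Vec (Fin n) k) → letters v ≡ letters v′ → v ≡ v′
letters-injective V.[] V.[] _ = refl
letters-injective (x V.∷ v) (y V.∷ v′) eq with ∷-injective eq
... | x≡y , eq′ = cong₂ V._∷_ (toℕ-injective x≡y) (letters-injective v v′ eq′)

letters-bounded : ∀ {k} (v : Vec (Fin n) k) → All (_< n) (letters v)
letters-bounded V.[] = []
letters-bounded (x V.∷ v) = toℕ<n x ∷ letters-bounded v

letters-size : ∀ {k} (v : Vec (Fin n) k) → length (letters v) ≡ k
letters-size V.[] = refl
letters-size (x V.∷ v) = cong suc (letters-size v)

letters-surjective : ∀ {k} (w : List ℕ) → All (_< n) w → length w ≡ k → ∃ λ (v : Vec (Fin n) k) → letters v ≡ w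
letters-surjective [] [] refl = V.[] , refl
letters-surjective (x ∷ w) (x<n ∷ b) refl with letters-surjective w b refl
... | v , eq = fromℕ< x<n V.∷ v , cong₂ _∷_ (toℕ-fromℕ< x<n) eq

allWords-∈ : ∀ {as : List A} → (∀ a → a ∈ as) → ∀ {k} (v : Vec A k) → v ∈ allWords as k
allWords-∈ all V.[] = here refl
allWords-∈ {as = as} all {suc k} (x V.∷ v) = ∈-concatMap⁺ (λ a → map (a V.∷_) (allWords as k))
  (lose (all x) (∈-map⁺ (x V.∷_) (allWords-∈ all v)))

allWords-unique : ∀ {as : List A} → Unique as → ∀ k → Unique (allWords as k)
allWords-unique u zero = [] ∷ []
allWords-unique {as = as} u (suc k) = concatMap-unique _ u
  (λ {a} _ → Unique.map⁺ V.∷-injectiveʳ (allWords-unique u k))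
  λ _ _ → same-head
  where
  same-head : ∀ {a b v} → v ∈ map (a V.∷_) (allWords as k) → v ∈ map (b V.∷_) (allWords as k) → a ≡ b
  same-head p q with ∈-map⁻ _ p | ∈-map⁻ _ q
  ... | _ , _ , refl | _ , _ , eq = V.∷-injectiveˡ eq

T-not-≡ᵇ⇒≢ : ∀ {x y} → T (not (x ≡ᵇ y)) → x ≢ y
T-not-≡ᵇ⇒≢ {x} {y} t x≡y with x ≡ᵇ y | ≡⇒≡ᵇ x y x≡y
... | false | ()

≢⇒T-not-≡ᵇ : ∀ {x y} → x ≢ y → T (not (x ≡ᵇ y))
≢⇒T-not-≡ᵇ {x} {y} x≢y with x ≡ᵇ y in eq
... | true  = x≢y (≡ᵇ⇒≡ x y (subst T (sym eq) _))
... | false = _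

T-and⇒All : (p : A → Bool) (xs : List A) → T (and (map p xs)) → All (T ∘ p) xs
T-and⇒All p [] _ = []
T-and⇒All p (x ∷ xs) t with Equivalence.to T-∧ t
... | px , pxs = px ∷ T-and⇒All p xs pxs

All⇒T-and : (p : A → Bool) {xs : List A} → All (T ∘ p) xs → T (and (map p xs))
All⇒T-and p [] = _
All⇒T-and p (px ∷ pxs) = Equivalence.from T-∧ (px , All⇒T-and p pxs)

allDistinct⇒Unique : ∀ xs → T (allDistinct xs) → Unique xs
allDistinct⇒Unique [] _ = []
allDistinct⇒Unique (x ∷ xs) t with Equivalence.to T-∧ t
... | p , q = All.map T-not-≡ᵇ⇒≢ (T-and⇒All _ xs p) ∷ allDistinct⇒Unique xs q

Unique⇒allDistinct : ∀ {xs} → Unique xs → T (allDistinct xs)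
Unique⇒allDistinct [] = _
Unique⇒allDistinct (p ∷ u) = Equivalence.from T-∧ (All⇒T-and _ (All.map ≢⇒T-not-≡ᵇ p) , Unique⇒allDistinct u)

permWords : ℕ → List (List ℕ)
permWords n = map letters (allPerms n)

allPerms-unique : ∀ n → Unique (allPerms n)
allPerms-unique n = Unique.filter⁺ (T? ∘ isPerm) (allWords-unique (Unique.allFin⁺ n) n)

permWords-unique : ∀ n → Unique (permWords n)
permWords-unique n = Unique.map⁺ (letters-injective _ _) (allPerms-unique n)

allPerms⇒permWord : {π : Vec (Fin n) n} → π ∈ allPerms n → IsPermWord n (letters π)
allPerms⇒permWord {n} {π} π∈ = permWord
  (allDistinct⇒Unique _ (proj₂ (∈-filter⁻ (T? ∘ isPerm) {xs = allWords (allFin n) n} π∈))) (letters-bounded π) (letters-size π)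

permWords⇒permWord : ∀ {w} → w ∈ permWords n → IsPermWord n w
permWords⇒permWord w∈ with ∈-map⁻ letters w∈
... | π , π∈ , refl = allPerms⇒permWord π∈

permWord⇒permWords : ∀ {w} → IsPermWord n w → w ∈ permWords n
permWord⇒permWords {n} {w} (permWord u b s) with letters-surjective w b s
... | π , refl = ∈-map⁺ letters (∈-filter⁺ (T? ∘ isPerm) (allWords-∈ ∈-allFin π) (Unique⇒allDistinct u))

-- The generating tree

-- Level n of the tree with root 0 in which k has the children k + 1, ..., 1. The list stands for a
-- multiset and is compared only up to permutation.
labels : ℕ → List ℕ
labels zero    = 0 ∷ []
labels (suc n) = concatMap (λ k → map suc (downFrom (suc k))) (labels n)

indicator : Bool → ℕ
indicator b = if b then 1 else 0

count-concatMap : (p : B → Bool) (f : A → List B) (q : A → Bool) →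
  (∀ x → count p (f x) ≡ indicator (q x)) → ∀ xs → count p (concatMap f xs) ≡ count q xs
count-concatMap p f q h [] = refl
count-concatMap p f q h (x ∷ xs) = trans (count-++ p (f x) (concatMap f xs)) (step (count-concatMap p f q h xs))
  where
  step : count p (concatMap f xs) ≡ count q xs → count p (f x) + count p (concatMap f xs) ≡ count q (x ∷ xs)
  step ih rewrite h x with q x
  ... | true  = cong suc ih
  ... | false = ih

≡ᵇ-refl : ∀ m → (m ≡ᵇ m) ≡ true
≡ᵇ-refl zero = refl
≡ᵇ-refl (suc m) = ≡ᵇ-refl m

<⇒≡ᵇ-false : ∀ {k m} → k < m → (k ≡ᵇ m) ≡ false
<⇒≡ᵇ-false {zero}  {suc m} _ = refl
<⇒≡ᵇ-false {suc k} {suc m} (s≤s lt) = <⇒≡ᵇ-false lt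

count-downFrom-≥ : ∀ {m} k → k ≤ m → count (_≡ᵇ m) (downFrom k) ≡ 0
count-downFrom-≥ zero _ = refl
count-downFrom-≥ (suc k) lt rewrite <⇒≡ᵇ-false lt = count-downFrom-≥ k (<⇒≤ lt)

count-downFrom : ∀ m k → count (_≡ᵇ m) (downFrom (suc k)) ≡ indicator (m ≤ᵇ k)
count-downFrom zero zero = refl
count-downFrom (suc m) zero = refl
count-downFrom zero (suc k) = count-downFrom zero k
count-downFrom (suc m) (suc k) with k ≡ᵇ m in eq
... | true rewrite sym (≡ᵇ⇒≡ k m (subst T (sym eq) _)) = trans (cong suc (count-downFrom-≥ (suc k) ≤-refl)) (sym (cong indicator (n<ᵇ1+n k)))
  where
  n<ᵇ1+n : ∀ k → (k <ᵇ suc k) ≡ true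
  n<ᵇ1+n zero = refl
  n<ᵇ1+n (suc k) = n<ᵇ1+n k
... | false = trans (count-downFrom (suc m) k) (cong indicator (weaken m k eq))
  where
  weaken : ∀ m k → (k ≡ᵇ m) ≡ false → (m <ᵇ k) ≡ (m <ᵇ suc k)
  weaken zero    zero    ()
  weaken zero    (suc k) _ = refl
  weaken (suc m) zero    _ = refl
  weaken (suc m) (suc k) eq = weaken m k eq

-- A node k has one child labelled m + 1 if m ≤ k, and none otherwise.
count-labels-suc : ∀ m n → count (_≡ᵇ suc m) (labels (suc n)) ≡ count (m ≤ᵇ_) (labels n)
count-labels-suc m n = count-concatMap _ _ (m ≤ᵇ_)
  (λ k → trans (count-map (_≡ᵇ suc m) suc (downFrom (suc k))) (count-downFrom m k)) (labels n)

count-labels-zero : ∀ n → count (_≡ᵇ 0) (labels (suc n)) ≡ 0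
count-labels-zero n = trans (count-concatMap _ _ (λ _ → false)
  (λ k → trans (count-map (_≡ᵇ 0) suc (downFrom (suc k))) (count-false (λ _ → refl) (downFrom (suc k)))) (labels n))
  (count-false (λ _ → refl) (labels n))

count-≤-split : ∀ m xs → count (m ≤ᵇ_) xs ≡ count (_≡ᵇ m) xs + count (suc m ≤ᵇ_) xs
count-≤-split m [] = refl
count-≤-split m (x ∷ xs) with m ≤ᵇ x | x ≡ᵇ m | m <ᵇ x | cases m x
  where
  cases : ∀ m x → indicator (m ≤ᵇ x) ≡ indicator (x ≡ᵇ m) + indicator (m <ᵇ x)
  cases zero zero = refl
  cases zero (suc x) = refl
  cases (suc m) zero = refl
  cases (suc zero) (suc x) = cases zero x
  cases (suc (suc m)) (suc x) = cases (suc m) x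
... | true  | true  | false | _ = cong suc (count-≤-split m xs)
... | true  | false | true  | _ = trans (cong suc (count-≤-split m xs)) (sym (+-suc _ _))
... | false | false | false | _ = count-≤-split m xs

count-labels-rec : ∀ m n →
  count (_≡ᵇ suc m) (labels (suc n)) ≡ count (_≡ᵇ m) (labels n) + count (_≡ᵇ suc (suc m)) (labels (suc n))
count-labels-rec m n = trans (count-labels-suc m n) (trans (count-≤-split m (labels n))
  (cong (count (_≡ᵇ m) (labels n) +_) (sym (count-labels-suc (suc m) n))))

labels-≤ : ∀ n → All (_≤ n) (labels n)
labels-≤ zero = z≤n ∷ []
labels-≤ (suc n) = All.concat⁺ (All.map⁺ (All.map (λ k≤n → All.map⁺ (All.tabulate (λ j∈ → ≤-trans (∈-downFrom⁻ j∈) (s≤s k≤n)))) (labels-≤ n)))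

count-labels-> : ∀ {m n} → n < m → count (_≡ᵇ m) (labels n) ≡ 0
count-labels-> {m} {n} n<m = none (labels-≤ n)
  where
  none : ∀ {xs} → All (_≤ n) xs → count (_≡ᵇ m) xs ≡ 0
  none [] = refl
  none (x≤n ∷ b) rewrite <⇒≡ᵇ-false (≤-trans (s≤s x≤n) n<m) = none b

-- `count-labels-rec` is the recursion of `ballot`; at i = 0 its last term vanishes because labels
-- on level n are at most n.
count-labels : ∀ p i → count (_≡ᵇ p) (labels (p + i)) ≡ ballot p i
count-labels zero    zero    = refl
count-labels zero    (suc i) = count-labels-zero i
count-labels (suc p) zero    = trans (count-labels-rec p (p + 0))
  (cong₂ _+_ (trans (count-labels p 0) (ballot-0 p)) (count-labels-> (s≤s (s≤s (≤-reflexive (+-identityʳ p))))))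
count-labels (suc p) (suc i) = trans (count-labels-rec p (p + suc i))
  (cong₂ _+_ (count-labels p (suc i))
    (trans (cong (λ k → count (_≡ᵇ suc (suc p)) (labels (suc k))) (+-suc p i)) (count-labels (suc (suc p)) i)))

-- Soundness, completeness and joint injectivity of `insert` make level n + 1 the disjoint union of
-- the sets of children. `stat-insert` is an equality of lists, so `slots` has to be enumerated by
-- decreasing statistic of the child. `stat` receives the size as the sentinel for `lrmins`.
record InsertionTree (good : List ℕ → Bool) (stat : ℕ → List ℕ → ℕ) : Set where
  field
    insert   : ℕ → List ℕ → List ℕ
    slots    : ℕ → List ℕ → List ℕ
    good-[]  : good [] ≡ true
    stat-[]  : stat 0 [] ≡ 0
    slots-unique : ∀ {n w} → IsPermWord n w → Unique (slots n w)
    insert-injective : ∀ {n v v′ w w′} → IsPermWord n w → IsPermWord n w′ → v ∈ slots n w → v′ ∈ slots n w′ →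
      insert v w ≡ insert v′ w′ → v ≡ v′ × w ≡ w′
    insert-sound : ∀ {n v w} → IsPermWord n w → T (good w) → v ∈ slots n w →
      IsPermWord (suc n) (insert v w) × T (good (insert v w))
    insert-complete : ∀ {n x} → IsPermWord (suc n) x → T (good x) →
      ∃₂ λ v w → x ≡ insert v w × IsPermWord n w × T (good w) × v ∈ slots n w
    stat-insert : ∀ {n w} → IsPermWord n w → T (good w) →
      map (λ v → stat (suc n) (insert v w)) (slots n w) ≡ map suc (downFrom (suc (stat n w)))

  goodWords : ℕ → List (List ℕ)
  goodWords n = filterᵇ good (permWords n)

  goodWords⁻ : ∀ {n w} → w ∈ goodWords n → IsPermWord n w × T (good w)
  goodWords⁻ {n} w∈ with ∈-filter⁻ (T? ∘ good) {xs = permWords n} w∈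
  ... | w∈′ , g = permWords⇒permWord w∈′ , g

  goodWords⁺ : ∀ {n w} → IsPermWord n w → T (good w) → w ∈ goodWords n
  goodWords⁺ pw g = ∈-filter⁺ (T? ∘ good) (permWord⇒permWords pw) g

  goodWords-unique : ∀ n → Unique (goodWords n)
  goodWords-unique n = Unique.filter⁺ (T? ∘ good) (permWords-unique n)

  children : ℕ → List ℕ → List (List ℕ)
  children n w = map (λ v → insert v w) (slots n w)

  goodWords-suc : ∀ n → goodWords (suc n) ↭ concatMap (children n) (goodWords n)
  goodWords-suc n = unique-⇔⇒↭
    (concatMap-unique (children n) (goodWords-unique n) (λ w∈ → children-unique (proj₁ (goodWords⁻ w∈)))
      (λ w∈ w′∈ → same-parent (proj₁ (goodWords⁻ w∈)) (proj₁ (goodWords⁻ w′∈))))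
    (goodWords-unique (suc n)) ⊆₁ ⊆₂
    where
    children-unique : ∀ {w} → IsPermWord n w → Unique (children n w)
    children-unique pw = map-unique _ (slots-unique pw) (λ v∈ v′∈ eq → proj₁ (insert-injective pw pw v∈ v′∈ eq))
    same-parent : ∀ {w w′ x} → IsPermWord n w → IsPermWord n w′ → x ∈ children n w → x ∈ children n w′ → w ≡ w′
    same-parent pw pw′ x∈ x∈′ with ∈-map⁻ _ x∈ | ∈-map⁻ _ x∈′
    ... | v , v∈ , refl | v′ , v′∈ , eq = proj₂ (insert-injective pw pw′ v∈ v′∈ eq)
    ⊆₁ : concatMap (children n) (goodWords n) ⊆ goodWords (suc n)
    ⊆₁ x∈ with find (∈-concatMap⁻ (children n) {xs = goodWords n} x∈)
    ... | w , w∈ , x∈′ with ∈-map⁻ _ x∈′ | goodWords⁻ {n} w∈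
    ... | v , v∈ , refl | pw , g with insert-sound pw g v∈
    ... | pw′ , g′ = goodWords⁺ pw′ g′
    ⊆₂ : goodWords (suc n) ⊆ concatMap (children n) (goodWords n)
    ⊆₂ x∈ with goodWords⁻ {suc n} x∈
    ... | px , gx with insert-complete px gx
    ... | v , w , refl , pw , g , v∈ =
      ∈-concatMap⁺ (children n) (lose (goodWords⁺ pw g) (∈-map⁺ _ v∈))

  stat-labels : ∀ n → map (stat n) (goodWords n) ↭ labels n
  stat-labels zero rewrite good-[] | stat-[] = ↭-refl
  stat-labels (suc n) = ↭-trans (Perm.map⁺ (stat (suc n)) (goodWords-suc n))
    (↭-trans (↭-reflexive (go (λ p → p))) (concatMap-↭ (stat-labels n)))
    where
    range : ℕ → List ℕ
    range k = map suc (downFrom (suc k))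
    -- The induction runs over sublists of `goodWords n`, because `stat-insert` speaks only of good
    -- permutation words.
    go : ∀ {ws} → ws ⊆ goodWords n → map (stat (suc n)) (concatMap (children n) ws) ≡ concatMap range (map (stat n) ws)
    go {[]} sub = refl
    go {w ∷ ws} sub = trans (map-++ (stat (suc n)) (children n w) _)
      (cong₂ _++_ (trans (sym (map-∘ (slots n w))) (let pw , g = goodWords⁻ (sub (here refl)) in stat-insert pw g)) (go (sub ∘ there)))
    concatMap-↭ : ∀ {xs ys} → xs ↭ ys → concatMap range xs ↭ concatMap range ys
    concatMap-↭ Perm.refl = ↭-refl
    concatMap-↭ (Perm.prep x p) = Perm.++⁺ˡ (range x) (concatMap-↭ p)
    concatMap-↭ (Perm.swap x y p) = ↭-trans (shifts (range x) (range y)) (Perm.++⁺ˡ (range y) (Perm.++⁺ˡ (range x) (concatMap-↭ p)))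
    concatMap-↭ (Perm.trans p q) = ↭-trans (concatMap-↭ p) (concatMap-↭ q)

  count-stat : ∀ n m → count (λ w → good w ∧ (stat n w ≡ᵇ m)) (permWords n) ≡ count (_≡ᵇ m) (labels n)
  count-stat n m = trans (split (permWords n))
    (trans (sym (count-map (_≡ᵇ m) (stat n) (goodWords n))) (count-↭ (_≡ᵇ m) (stat-labels n)))
    where
    split : ∀ ws → count (λ w → good w ∧ (stat n w ≡ᵇ m)) ws ≡ count (λ w → stat n w ≡ᵇ m) (filterᵇ good ws)
    split [] = refl
    split (w ∷ ws) with good w
    ... | false = split ws
    ... | true with stat n w ≡ᵇ m
    ...   | true  = cong suc (split ws)
    ...   | false = split ws

-- Pattern avoidance

-- Follows the recursion of `containsᵇ`, so that a new first letter adds a single `AllPairs`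
-- condition on the old word.
data Avoids (R : ℕ → ℕ → ℕ → Set) : List ℕ → Set where
  []  : Avoids R []
  _∷_ : ∀ {x w} → AllPairs (λ y z → ¬ R x y z) w → Avoids R w → Avoids R (x ∷ w)

Avoids-map⁺ : ∀ {R} (f : ℕ → ℕ) → (∀ {x y z} → R (f x) (f y) (f z) → R x y z) →
  ∀ {w} → Avoids R w → Avoids R (map f w)
Avoids-map⁺ f refl′ [] = []
Avoids-map⁺ f refl′ (p ∷ a) = AllPairs.map⁺ (AllPairs.map (_∘ refl′) p) ∷ Avoids-map⁺ f refl′ a

Avoids-map⁻ : ∀ {R} (f : ℕ → ℕ) → (∀ {x y z} → R x y z → R (f x) (f y) (f z)) →
  ∀ {w} → Avoids R (map f w) → Avoids R w
Avoids-map⁻ f pres {[]} [] = []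
Avoids-map⁻ f pres {x ∷ w} (p ∷ a) = AllPairs.map (_∘ pres) (AllPairs.map⁻ p) ∷ Avoids-map⁻ f pres a

¬T-or⇒All : (p : A → Bool) (xs : List A) → ¬ T (or (map p xs)) → All (¬_ ∘ T ∘ p) xs
¬T-or⇒All p [] _ = []
¬T-or⇒All p (x ∷ xs) h with p x in eq
... | true  = ⊥-elim (h _)
... | false = (λ t → subst T eq t) ∷ ¬T-or⇒All p xs h

All⇒¬T-or : (p : A → Bool) {xs : List A} → All (¬_ ∘ T ∘ p) xs → ¬ T (or (map p xs))
All⇒¬T-or p {x ∷ xs} (¬px ∷ a) t with p x
... | true  = ¬px _
... | false = All⇒¬T-or p a t

All-pairs⇒AllPairs : ∀ {Q : ℕ × ℕ → Set} xs → All Q (pairs xs) → AllPairs (λ y z → Q (y , z)) xs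
All-pairs⇒AllPairs [] _ = []
All-pairs⇒AllPairs (x ∷ xs) a with All.++⁻ (map (x ,_) xs) a
... | a₁ , a₂ = All.map⁻ a₁ ∷ All-pairs⇒AllPairs xs a₂

AllPairs⇒All-pairs : ∀ {Q : ℕ × ℕ → Set} {xs} → AllPairs (λ y z → Q (y , z)) xs → All Q (pairs xs)
AllPairs⇒All-pairs [] = []
AllPairs⇒All-pairs (a ∷ as) = All.++⁺ (All.map⁺ a) (AllPairs⇒All-pairs as)

¬T-∨⁻ : ∀ {a b} → ¬ T (a ∨ b) → ¬ T a × ¬ T b
¬T-∨⁻ {false} h = (λ ()) , h
¬T-∨⁻ {true}  h = ⊥-elim (h _)

¬T-∨⁺ : ∀ {a b} → ¬ T a → ¬ T b → ¬ T (a ∨ b)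
¬T-∨⁺ {false} _ ¬b = ¬b
¬T-∨⁺ {true}  ¬a _ = ¬a

T-not⇒¬T : ∀ {b} → T (not b) → ¬ T b
T-not⇒¬T {false} _ ()

¬T⇒T-not : ∀ {b} → ¬ T b → T (not b)
¬T⇒T-not {false} _ = _
¬T⇒T-not {true}  h = h _

avoids : Pattern3 → List ℕ → Bool
avoids σ w = not (containsᵇ σ w)

module AvoidsReflection (σ : Pattern3) (R : ℕ → ℕ → ℕ → Set)
  (R⇒iso : ∀ {x y z} → R x y z → T (orderIso σ x y z))
  (iso⇒R : ∀ {x y z} → T (orderIso σ x y z) → R x y z) where

  ¬contains⇒Avoids : ∀ w → ¬ T (containsᵇ σ w) → Avoids R w
  ¬contains⇒Avoids [] _ = []
  ¬contains⇒Avoids (x ∷ w) h with ¬T-∨⁻ h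
  ... | h₁ , h₂ = AllPairs.map (_∘ R⇒iso) (All-pairs⇒AllPairs w (¬T-or⇒All _ (pairs w) h₁)) ∷ ¬contains⇒Avoids w h₂

  Avoids⇒¬contains : ∀ {w} → Avoids R w → ¬ T (containsᵇ σ w)
  Avoids⇒¬contains [] = λ ()
  Avoids⇒¬contains (p ∷ a) =
    ¬T-∨⁺ (All⇒¬T-or _ (AllPairs⇒All-pairs (AllPairs.map (_∘ iso⇒R) p))) (Avoids⇒¬contains a)

  avoids⇒Avoids : ∀ w → T (avoids σ w) → Avoids R w
  avoids⇒Avoids w t = ¬contains⇒Avoids w (T-not⇒¬T t)

  Avoids⇒avoids : ∀ {w} → Avoids R w → T (avoids σ w)
  Avoids⇒avoids a = ¬T⇒T-not (Avoids⇒¬contains a)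

-- Each order type is a chain of two strict inequalities; the other comparisons in `orderIso` follow
-- by transitivity and asymmetry.
R312 R231 R213 : ℕ → ℕ → ℕ → Set
R312 x y z = y < z × z < x
R231 x y z = z < x × x < y
R213 x y z = y < x × x < z

T-∧⁺ : ∀ {a b} → T a → T b → T (a ∧ b)
T-∧⁺ p q = Equivalence.from T-∧ (p , q)

≯ᵇ : ∀ {x y} → y < x → T (not (x <ᵇ y))
≯ᵇ {x} {y} y<x = ¬T⇒T-not (λ t → <-asym y<x (<ᵇ⇒< x y t))

R312⇒iso : ∀ {x y z} → R312 x y z → T (orderIso p312 x y z)
R312⇒iso (y<z , z<x) = T-∧⁺ (≯ᵇ y<x) (T-∧⁺ (≯ᵇ z<x) (T-∧⁺ (<⇒<ᵇ y<z) (T-∧⁺ (<⇒<ᵇ y<x) (T-∧⁺ (<⇒<ᵇ z<x) (≯ᵇ y<z)))))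
  where y<x = <-trans y<z z<x

R231⇒iso : ∀ {x y z} → R231 x y z → T (orderIso p231 x y z)
R231⇒iso (z<x , x<y) = T-∧⁺ (<⇒<ᵇ x<y) (T-∧⁺ (≯ᵇ z<x) (T-∧⁺ (≯ᵇ z<y) (T-∧⁺ (≯ᵇ x<y) (T-∧⁺ (<⇒<ᵇ z<x) (<⇒<ᵇ z<y)))))
  where z<y = <-trans z<x x<y

R213⇒iso : ∀ {x y z} → R213 x y z → T (orderIso p213 x y z)
R213⇒iso (y<x , x<z) = T-∧⁺ (≯ᵇ y<x) (T-∧⁺ (<⇒<ᵇ x<z) (T-∧⁺ (<⇒<ᵇ y<z) (T-∧⁺ (<⇒<ᵇ y<x) (T-∧⁺ (≯ᵇ x<z) (≯ᵇ y<z)))))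
  where y<z = <-trans y<x x<z

T-∧⁻⁶ : ∀ a b c d e f → T (a ∧ b ∧ c ∧ d ∧ e ∧ f) → T a × T b × T c × T d × T e × T f
T-∧⁻⁶ true true true true true true _ = _

iso⇒R312 : ∀ {x y z} → T (orderIso p312 x y z) → R312 x y z
iso⇒R312 {x} {y} {z} t
  with T-∧⁻⁶ (not (x <ᵇ y)) (not (x <ᵇ z)) (y <ᵇ z) (y <ᵇ x) (z <ᵇ x) (not (z <ᵇ y)) t
... | _ , _ , y<z , _ , z<x , _ = <ᵇ⇒< y z y<z , <ᵇ⇒< z x z<x

iso⇒R231 : ∀ {x y z} → T (orderIso p231 x y z) → R231 x y z
iso⇒R231 {x} {y} {z} t
  with T-∧⁻⁶ (x <ᵇ y) (not (x <ᵇ z)) (not (y <ᵇ z)) (not (y <ᵇ x)) (z <ᵇ x) (z <ᵇ y) t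
... | x<y , _ , _ , _ , z<x , _ = <ᵇ⇒< z x z<x , <ᵇ⇒< x y x<y

iso⇒R213 : ∀ {x y z} → T (orderIso p213 x y z) → R213 x y z
iso⇒R213 {x} {y} {z} t
  with T-∧⁻⁶ (not (x <ᵇ y)) (x <ᵇ z) (y <ᵇ z) (y <ᵇ x) (not (z <ᵇ x)) (not (z <ᵇ y)) t
... | _ , x<z , _ , y<x , _ , _ = <ᵇ⇒< y x y<x , <ᵇ⇒< x z x<z

module A312 = AvoidsReflection p312 R312 R312⇒iso iso⇒R312
module A231 = AvoidsReflection p231 R231 R231⇒iso iso⇒R231
module A213 = AvoidsReflection p213 R213 R213⇒iso iso⇒R213

-- Left-to-right minima

-- c is a sentinel: if all letters of w are below c, these are all the left-to-right minima of w.
lrmins : ℕ → List ℕ → List ℕ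
lrmins c [] = []
lrmins c (x ∷ w) with x <? c
... | yes _ = x ∷ lrmins x w
... | no _  = lrmins c w

lrmins-< : ∀ {c x} w → x < c → lrmins c (x ∷ w) ≡ x ∷ lrmins x w
lrmins-< {c} {x} w x<c with x <? c
... | yes _  = refl
... | no x≮c = contradiction x<c x≮c

lrmins-≥ : ∀ {c x} w → c ≤ x → lrmins c (x ∷ w) ≡ lrmins c w
lrmins-≥ {c} {x} w c≤x with x <? c
... | yes x<c = contradiction c≤x (<⇒≱ x<c)
... | no _    = refl

lrmins-bounded : ∀ c w → All (_< c) (lrmins c w)
lrmins-bounded c [] = []
lrmins-bounded c (x ∷ w) with x <? c
... | yes x<c = x<c ∷ All.map (λ v<x → <-trans v<x x<c) (lrmins-bounded x w)
... | no _    = lrmins-bounded c w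

∷-lrmins-unique : ∀ c w → Unique (c ∷ lrmins c w)
lrmins-unique : ∀ c w → Unique (lrmins c w)
∷-lrmins-unique c w = All.map >⇒≢ (lrmins-bounded c w) ∷ lrmins-unique c w
lrmins-unique c [] = []
lrmins-unique c (x ∷ w) with x <? c
... | yes _ = ∷-lrmins-unique x w
... | no _  = lrmins-unique c w

#lrmins : ℕ → List ℕ → ℕ
#lrmins c w = length (lrmins c w)

-- For a minimum v, `lrmins v w` consists of the minima after v, so the count drops by one from each
-- minimum to the next. This gives the labels of the children in the 2-1-3 tree.
#lrmins-lrmins : ∀ c w → map (λ v → #lrmins v w) (lrmins c w) ≡ downFrom (#lrmins c w)
#lrmins-lrmins c [] = refl
#lrmins-lrmins c (x ∷ w) with x <? c
... | yes _   = cong₂ _∷_ (cong length (lrmins-≥ w ≤-refl)) (trans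
  (map-cong-local (All.map (λ v<x → cong length (lrmins-≥ w (<⇒≤ v<x))) (lrmins-bounded x w))) (#lrmins-lrmins x w))
... | no x≮c = trans
  (map-cong-local (All.map (λ v<c → cong length (lrmins-≥ w (≤-trans (<⇒≤ v<c) (≮⇒≥ x≮c)))) (lrmins-bounded c w)))
  (#lrmins-lrmins c w)

-- Prepending a letter and renumbering the others

bump : ℕ → ℕ → ℕ
bump v x with x <? v
... | yes _ = x
... | no _  = suc x

bump-< : ∀ {v x} → x < v → bump v x ≡ x
bump-< {v} {x} x<v with x <? v
... | yes _  = refl
... | no x≮v = contradiction x<v x≮v

bump-≥ : ∀ {v x} → v ≤ x → bump v x ≡ suc x
bump-≥ {v} {x} v≤x with x <? v
... | yes x<v = contradiction v≤x (<⇒≱ x<v)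
... | no _    = refl

bump-mono : ∀ v {x y} → x < y → bump v x < bump v y
bump-mono v {x} {y} x<y with x <? v | y <? v
... | yes _   | yes _   = x<y
... | yes _   | no _    = m<n⇒m<1+n x<y
... | no x≮v | yes y<v = contradiction (<-trans x<y y<v) x≮v
... | no _    | no _    = s≤s x<y

bump-reflects : ∀ v {x y} → bump v x < bump v y → x < y
bump-reflects v {x} {y} lt with <-cmp x y
... | tri< x<y _ _ = x<y
... | tri≈ _ refl _ = contradiction lt (<-irrefl refl)
... | tri> _ _ y<x = contradiction (bump-mono v y<x) (<-asym lt)

bump-injective : ∀ v {x y} → bump v x ≡ bump v y → x ≡ y
bump-injective v {x} {y} eq with <-cmp x y
... | tri< x<y _ _ = contradiction eq (<⇒≢ (bump-mono v x<y))
... | tri≈ _ x≡y _ = x≡y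
... | tri> _ _ y<x = contradiction (sym eq) (<⇒≢ (bump-mono v y<x))

bump-≢ : ∀ v x → v ≢ bump v x
bump-≢ v x with x <? v
... | yes x<v = λ v≡x → <⇒≢ x<v (sym v≡x)
... | no x≮v  = <⇒≢ (s≤s (≮⇒≥ x≮v))

bump<v : ∀ {v x} → bump v x < v → x < v
bump<v {v} {x} lt with x <? v
... | yes x<v = x<v
... | no _    = <-trans (n<1+n x) lt

v<bump : ∀ {v x} → v < bump v x → v ≤ x
v<bump {v} {x} lt with x <? v
... | yes x<v = <⇒≤ lt
... | no x≮v  = ≮⇒≥ x≮v

bump-bounded : ∀ {v x} → x < n → bump v x < suc n
bump-bounded {v = v} {x} x<n with x <? v
... | yes _ = m<n⇒m<1+n x<n
... | no _  = s≤s x<n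

bump-bounded⁻ : ∀ {v x} → v ≤ n → bump v x < suc n → x < n
bump-bounded⁻ {v = v} {x} v≤n lt with x <? v
... | yes x<v = <-≤-trans x<v v≤n
... | no _    = s≤s⁻¹ lt

bump-surjective : ∀ {v y} → v ≢ y → ∃ λ x → bump v x ≡ y
bump-surjective {v} {y} v≢y with <-cmp y v
... | tri< y<v _ _ = y , bump-< y<v
... | tri≈ _ y≡v _ = contradiction (sym y≡v) v≢y
bump-surjective {v} {suc y} v≢y | tri> _ _ (s≤s v≤y) = y , bump-≥ v≤y

prepend : ℕ → List ℕ → List ℕ
prepend v w = v ∷ map (bump v) w

prepend-injective : ∀ {v v′ w w′} → prepend v w ≡ prepend v′ w′ → v ≡ v′ × w ≡ w′
prepend-injective {v} eq with ∷-injective eq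
... | refl , eq′ = refl , map-injective (bump-injective v) eq′

prepend-permWord : ∀ {v w} → v ≤ n → IsPermWord n w → IsPermWord (suc n) (prepend v w)
prepend-permWord {v = v} {w} v≤n (permWord u b s) = permWord
  (All.map⁺ (All.tabulate (λ {x} _ → bump-≢ v x)) ∷ Unique.map⁺ (bump-injective v) u)
  (s≤s v≤n ∷ All.map⁺ (All.map (bump-bounded {v = v}) b))
  (cong suc (trans (length-map (bump v) w) s))

prepend-surjective : ∀ {x} → IsPermWord (suc n) x → ∃₂ λ v w → x ≡ prepend v w × v ≤ n × IsPermWord n w
prepend-surjective {x = v ∷ t} (permWord (v∉t ∷ u) (s≤s v≤n ∷ b) s) with unmap v∉t
  where
  unmap : ∀ {t} → All (v ≢_) t → ∃ λ w → map (bump v) w ≡ t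
  unmap [] = [] , refl
  unmap (v≢y ∷ a) with bump-surjective v≢y | unmap a
  ... | x , refl | w , refl = x ∷ w , refl
... | w , refl = v , w , refl , v≤n , permWord (Unique.map⁻ u)
  (All.map (bump-bounded⁻ v≤n) (All.map⁻ b)) (suc-injective (trans (cong suc (sym (length-map (bump v) w))) s))

-- Letters below c are fixed, and the others stay at or above c.
lrmins-bump : ∀ {c v} w → c ≤ v → lrmins c (map (bump v) w) ≡ lrmins c w
lrmins-bump [] _ = refl
lrmins-bump {c} {v} (x ∷ w) c≤v with x <? c
... | yes x<c rewrite bump-< (<-≤-trans x<c c≤v) = trans (lrmins-< (map (bump v) w) x<c)
  (cong (x ∷_) (lrmins-bump w (<⇒≤ (<-≤-trans x<c c≤v))))
... | no x≮c = trans (lrmins-≥ (map (bump v) w) (≤-trans (≮⇒≥ x≮c) x≤bump)) (lrmins-bump w c≤v)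
  where
  x≤bump : x ≤ bump v x
  x≤bump with x <? v
  ... | yes _ = ≤-refl
  ... | no _  = n≤1+n x

#lrmins-prepend : ∀ {v} w → v ≤ n → #lrmins (suc n) (prepend v w) ≡ suc (#lrmins v w)
#lrmins-prepend {v = v} w v≤n = trans (cong length (lrmins-< (map (bump v) w) (s≤s v≤n)))
  (cong (suc ∘ length) (lrmins-bump w ≤-refl))

AllPairs-zip-All : ∀ {P Q : ℕ → ℕ → Set} {S : ℕ → Set} → (∀ {y z} → S z → P y z → Q y z) →
  ∀ {w} → All S w → AllPairs P w → AllPairs Q w
AllPairs-zip-All f [] [] = []
AllPairs-zip-All f (s ∷ ss) (p ∷ ps) = All.zipWith (λ (s , p) → f s p) (ss , p) ∷ AllPairs-zip-All f ss ps

AllPairs-fromAll : ∀ {Q : ℕ → ℕ → Set} {S : ℕ → Set} → (∀ {y z} → S z → Q y z) → ∀ {w} → All S w → AllPairs Q w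
AllPairs-fromAll f [] = []
AllPairs-fromAll f (_ ∷ ss) = All.map f ss ∷ AllPairs-fromAll f ss

-- The pattern 2–1–3

-- Letters before a left-to-right minimum v exceed v; after it, a letter below v followed by one
-- above v would complete 2-1-3 with v. The weak bound `v ≤ z` becomes strict under `bump v`.
slot213 : ∀ {v w} c → Unique w → Avoids R213 w → v ∈ lrmins c w → AllPairs (λ y z → ¬ (y < v × v ≤ z)) w
slot213 {w = x ∷ w} c (x∉w ∷ u) (p ∷ a) v∈ with x <? c
slot213 {w = x ∷ w} c (x∉w ∷ u) (p ∷ a) (here refl) | yes _ =
  All.tabulate (λ _ (x<x , _) → <-irrefl refl x<x)
  ∷ AllPairs-zip-All (λ x≢z h (y<x , x≤z) → h (y<x , ≤∧≢⇒< x≤z x≢z)) x∉w p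
slot213 {w = x ∷ w} c (x∉w ∷ u) (p ∷ a) (there v∈) | yes _ =
  All.tabulate (λ _ (x<v , _) → <-asym x<v (All.lookup (lrmins-bounded x w) v∈))
  ∷ slot213 x u a v∈
... | no x≮c =
  All.tabulate (λ _ (x<v , _) → x≮c (<-trans x<v (All.lookup (lrmins-bounded c w) v∈)))
  ∷ slot213 c u a v∈

-- A smaller letter y in front of v would form the excluded pair with z = v.
slot213⁻ : ∀ {v w} c → v < c → v ∈ w → AllPairs (λ y z → ¬ (y < v × v ≤ z)) w → v ∈ lrmins c w
slot213⁻ {v} {x ∷ w} c v<c v∈ (p ∷ ps) with x <? c | v∈
... | yes _  | here v≡x = here v≡x
... | no x≮c | here refl = contradiction v<c x≮c
... | no _   | there v∈w = slot213⁻ c v<c v∈w ps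
... | yes _  | there v∈w with <-cmp v x
...   | tri< v<x _ _ = there (slot213⁻ x v<x v∈w ps)
...   | tri≈ _ v≡x _ = here v≡x
...   | tri> _ _ x<v = ⊥-elim (All.lookup p v∈w (x<v , ≤-refl))

tree213 : InsertionTree (avoids p213) #lrmins
tree213 = record
  { insert = prepend
  ; slots = λ n w → n ∷ lrmins n w
  ; good-[] = refl
  ; stat-[] = refl
  ; slots-unique = λ {n} {w} _ → ∷-lrmins-unique n w
  ; insert-injective = λ _ _ _ _ → prepend-injective
  ; insert-sound = λ {_} {_} {w} pw g v∈ → prepend-permWord (slot≤ {w = w} v∈) pw , A213.Avoids⇒avoids (sound pw (A213.avoids⇒Avoids _ g) v∈)
  ; insert-complete = complete
  ; stat-insert = λ {n} {w} _ _ → trans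
      (map-cong-local (All.tabulate (λ v∈ → #lrmins-prepend w (slot≤ {w = w} v∈))))
      (trans (map-∘ (n ∷ lrmins n w)) (cong (map suc) (cong (#lrmins n w ∷_) (#lrmins-lrmins n w))))
  }
  where
  slot≤ : ∀ {n v w} → v ∈ n ∷ lrmins n w → v ≤ n
  slot≤ (here refl) = ≤-refl
  slot≤ {n} {w = w} (there v∈) = <⇒≤ (All.lookup (lrmins-bounded n w) v∈)
  slot : ∀ {n v w} → IsPermWord n w → Avoids R213 w → v ∈ n ∷ lrmins n w → AllPairs (λ y z → ¬ (y < v × v ≤ z)) w
  -- In the extra slot v = n no old letter is large enough to play the 3.
  slot pw a (here refl) = AllPairs-fromAll (λ z<n (_ , n≤z) → <⇒≱ z<n n≤z) (bounded pw)
  slot pw a (there v∈) = slot213 _ (unique pw) a v∈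
  sound : ∀ {n v w} → IsPermWord n w → Avoids R213 w → v ∈ n ∷ lrmins n w → Avoids R213 (prepend v w)
  sound {v = v} pw a v∈ =
    AllPairs.map⁺ (AllPairs.map (λ h (lt , gt) → h (bump<v lt , v<bump gt)) (slot pw a v∈))
    ∷ Avoids-map⁺ (bump v) (λ (p , q) → bump-reflects v p , bump-reflects v q) a
  complete : ∀ {n x} → IsPermWord (suc n) x → T (avoids p213 x) →
      ∃₂ λ v w → x ≡ prepend v w × IsPermWord n w × T (avoids p213 w) × v ∈ n ∷ lrmins n w
  complete {n} px g with prepend-surjective px
  ... | v , w , refl , v≤n , pw with A213.avoids⇒Avoids _ g
  ... | p ∷ a = v , w , refl , pw
    , A213.Avoids⇒avoids (Avoids-map⁻ (bump v) (λ (p , q) → bump-mono v p , bump-mono v q) a) , v∈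
    where
    v∈ : v ∈ n ∷ lrmins n w
    v∈ with v ≟ n
    ... | yes v≡n = here v≡n
    ... | no v≢n = there (slot213⁻ n v<n (permWord-∈ pw v<n)
        (AllPairs.map (λ h (y<v , v≤z) → h (subst (_< v) (sym (bump-< y<v)) y<v , subst (v <_) (sym (bump-≥ v≤z)) (s≤s v≤z))) (AllPairs.map⁻ p)))
      where v<n = ≤∧≢⇒< v≤n v≢n

-- The pattern 3–1–2

-- For words avoiding 3-1-2 this is both the number of minima and the largest letter that may be
-- prepended.
headStat : List ℕ → ℕ
headStat []      = 0
headStat (h ∷ _) = suc h

headStat-≤ : ∀ {w} → IsPermWord n w → headStat w ≤ n
headStat-≤ {w = []}    _ = z≤n
headStat-≤ {w = h ∷ w} pw = All.head (bounded pw)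

-- If v ≤ h + 1, every z < v other than h lies below h, so a pair y < z < v after h would already
-- form 3-1-2 with h.
slot312 : ∀ {v w} → Unique w → Avoids R312 w → v ≤ headStat w → AllPairs (λ y z → ¬ (y < z × z < v)) w
slot312 {w = []} _ _ _ = []
slot312 {w = h ∷ w} (h∉w ∷ _) (p ∷ _) v≤ =
  All.tabulate (λ _ (h<z , z<v) → <⇒≱ h<z (s≤s⁻¹ (≤-trans z<v v≤)))
  ∷ AllPairs-zip-All (λ h≢z q (y<z , z<v) → q (y<z , ≤∧≢⇒< (s≤s⁻¹ (≤-trans z<v v≤)) (h≢z ∘ sym))) h∉w p

-- If v > h + 1, the letter h + 1 occurs after h, and the pair (h, h + 1) is excluded. For the empty
-- word n = 0 forces v = 0.
slot312⁻ : ∀ {v w} → IsPermWord n w → v ≤ n → AllPairs (λ y z → ¬ (y < z × z < v)) w → v ≤ headStat w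
slot312⁻ {w = []} (permWord _ _ refl) v≤n _ = v≤n
slot312⁻ {v = v} {w = h ∷ w} pw v≤n (p ∷ _) with v ≤? suc h
... | yes v≤ = v≤
... | no v≰ with permWord-∈ pw (≤-trans (≰⇒> v≰) v≤n)
...   | here eq = contradiction (sym eq) (<⇒≢ (n<1+n h))
...   | there h+1∈w = ⊥-elim (All.lookup p h+1∈w (n<1+n h , ≰⇒> v≰))

decreasing-lrmins : ∀ {i} c {w} → i ∈ w → i < c → AllPairs (λ y z → ¬ (y < z × z < c)) w → i ∈ lrmins c w
decreasing-lrmins {i} c {x ∷ w} i∈ i<c (p ∷ ps) with x <? c | i∈
... | yes _   | here i≡x = here i≡x
... | no x≮c  | here refl = contradiction i<c x≮c
... | no _    | there i∈w = decreasing-lrmins c i∈w i<c ps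
... | yes x<c | there i∈w with <-cmp i x
...   | tri< i<x _ _ = there (decreasing-lrmins x i∈w i<x (AllPairs.map (λ q (y<z , z<x) → q (y<z , <-trans z<x x<c)) ps))
...   | tri≈ _ i≡x _ = here i≡x
...   | tri> _ _ x<i = ⊥-elim (All.lookup p i∈w (x<i , i<c))

-- Letters below the first letter h come in decreasing order, so each of 0, ..., h - 1 is a minimum,
-- as is h itself.
#lrmins-312 : ∀ {w} → IsPermWord n w → Avoids R312 w → #lrmins n w ≡ headStat w
#lrmins-312 {w = []} _ _ = refl
#lrmins-312 {n} {h ∷ w} pw (p ∷ _) = trans (cong length (lrmins-< w h<n)) (cong suc
  (trans (↭-length (unique-⇔⇒↭ (Unique.upTo⁺ h) (lrmins-unique h w) below (λ v∈ → ∈-upTo⁺ (All.lookup (lrmins-bounded h w) v∈))))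
    (length-upTo h)))
  where
  h<n = All.head (bounded pw)
  below : upTo h ⊆ lrmins h w
  below i∈ with permWord-∈ pw (<-trans (∈-upTo⁻ i∈) h<n)
  ... | here refl = contradiction (∈-upTo⁻ i∈) (<-irrefl refl)
  ... | there i∈w = decreasing-lrmins h i∈w (∈-upTo⁻ i∈) p

tree312 : InsertionTree (avoids p312) #lrmins
tree312 = record
  { insert = prepend
  ; slots = λ _ w → downFrom (suc (headStat w))
  ; good-[] = refl
  ; stat-[] = refl
  ; slots-unique = λ {_} {w} _ → Unique.downFrom⁺ (suc (headStat w))
  ; insert-injective = λ _ _ _ _ → prepend-injective
  ; insert-sound = λ pw g v∈ → let pw′ , a = sound pw (A312.avoids⇒Avoids _ g) v∈ in pw′ , A312.Avoids⇒avoids a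
  ; insert-complete = complete
  ; stat-insert = λ {_} {w} pw g → let a = A312.avoids⇒Avoids w g in trans
      (map-cong-local (All.tabulate (λ v∈ → let pw′ , a′ = sound pw a v∈ in #lrmins-312 pw′ a′)))
      (cong (λ k → map suc (downFrom (suc k))) (sym (#lrmins-312 pw a)))
  }
  where
  sound : ∀ {n v w} → IsPermWord n w → Avoids R312 w → v ∈ downFrom (suc (headStat w)) →
    IsPermWord (suc n) (prepend v w) × Avoids R312 (prepend v w)
  sound {v = v} pw a v∈ = prepend-permWord (≤-trans v≤ (headStat-≤ pw)) pw
    , AllPairs.map⁺ (AllPairs.map (λ h (lt , lt′) → h (bump-reflects v lt , bump<v lt′)) (slot312 (unique pw) a v≤))
      ∷ Avoids-map⁺ (bump v) (λ (p , q) → bump-reflects v p , bump-reflects v q) a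
    where v≤ = s≤s⁻¹ (∈-downFrom⁻ v∈)
  complete : ∀ {n x} → IsPermWord (suc n) x → T (avoids p312 x) →
      ∃₂ λ v w → x ≡ prepend v w × IsPermWord n w × T (avoids p312 w) × v ∈ downFrom (suc (headStat w))
  complete {n} px g with prepend-surjective px
  ... | v , w , refl , v≤n , pw with A312.avoids⇒Avoids _ g
  ... | p ∷ a = v , w , refl , pw
    , A312.Avoids⇒avoids (Avoids-map⁻ (bump v) (λ (p , q) → bump-mono v p , bump-mono v q) a)
    , ∈-downFrom⁺ (s≤s (slot312⁻ pw v≤n
        (AllPairs.map (λ h (y<z , z<v) → h (bump-mono v y<z , subst (_< v) (sym (bump-< z<v)) z<v)) (AllPairs.map⁻ p))))

-- The pattern 2–3–1

-- Positions past the end are identified with the end, whence the bounds `p ≤ length w` for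
-- injectivity.
insertMin : ℕ → List ℕ → List ℕ
insertMin zero    w       = 0 ∷ map suc w
insertMin (suc p) []      = 0 ∷ []
insertMin (suc p) (x ∷ w) = suc x ∷ insertMin p w

All-insertMin⁺ : ∀ {P : ℕ → Set} p {w} → P 0 → All (P ∘ suc) w → All P (insertMin p w)
All-insertMin⁺ zero    p0 a = p0 ∷ All.map⁺ a
All-insertMin⁺ (suc p) p0 [] = p0 ∷ []
All-insertMin⁺ (suc p) p0 (px ∷ a) = px ∷ All-insertMin⁺ p p0 a

All-insertMin⁻ : ∀ {P : ℕ → Set} p w → All P (insertMin p w) → P 0 × All (P ∘ suc) w
All-insertMin⁻ zero    w       (p0 ∷ a) = p0 , All.map⁻ a
All-insertMin⁻ (suc p) []      (p0 ∷ []) = p0 , []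
All-insertMin⁻ (suc p) (x ∷ w) (px ∷ a) with All-insertMin⁻ p w a
... | p0 , a′ = p0 , px ∷ a′

AllPairs-insertMin⁻ : ∀ {Q : ℕ → ℕ → Set} p w → AllPairs Q (insertMin p w) → AllPairs (λ x y → Q (suc x) (suc y)) w
AllPairs-insertMin⁻ zero    w       (_ ∷ a) = AllPairs.map⁻ a
AllPairs-insertMin⁻ (suc p) []      _ = []
AllPairs-insertMin⁻ (suc p) (x ∷ w) (q ∷ a) = proj₂ (All-insertMin⁻ p w q) ∷ AllPairs-insertMin⁻ p w a

length-insertMin : ∀ p w → length (insertMin p w) ≡ suc (length w)
length-insertMin zero    w       = cong suc (length-map suc w)
length-insertMin (suc p) []      = refl
length-insertMin (suc p) (x ∷ w) = cong suc (length-insertMin p w)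

insertMin-unique : ∀ p {w} → Unique w → Unique (insertMin p w)
insertMin-unique zero    u = All.map⁺ (All.tabulate (λ _ ())) ∷ Unique.map⁺ suc-injective u
insertMin-unique (suc p) [] = [] ∷ []
insertMin-unique (suc p) (x∉w ∷ u) = All-insertMin⁺ p (λ ()) (All.map (_∘ suc-injective) x∉w) ∷ insertMin-unique p u

insertMin-permWord : ∀ p {w} → IsPermWord n w → IsPermWord (suc n) (insertMin p w)
insertMin-permWord p {w} (permWord u b s) = permWord
  (insertMin-unique p u) (All-insertMin⁺ p z<s (All.map s≤s b)) (trans (length-insertMin p w) (cong suc s))

insertMin-permWord⁻ : ∀ p w → IsPermWord (suc n) (insertMin p w) → IsPermWord n w
insertMin-permWord⁻ p w (permWord u b s) = permWord
  (AllPairs.map (λ h eq → h (cong suc eq)) (AllPairs-insertMin⁻ p w u))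
  (All.map s≤s⁻¹ (proj₂ (All-insertMin⁻ p w b)))
  (suc-injective (trans (sym (length-insertMin p w)) s))

insertMin-injective : ∀ {p p′ w w′} → p ≤ length w → p′ ≤ length w′ →
  insertMin p w ≡ insertMin p′ w′ → p ≡ p′ × w ≡ w′
insertMin-injective {zero}  {zero}  _ _ eq = refl , map-injective suc-injective (proj₂ (∷-injective eq))
insertMin-injective {zero}  {suc p′} {w} {x ∷ w′} _ _ ()
insertMin-injective {suc p} {zero} {x ∷ w} _ _ ()
insertMin-injective {suc p} {suc p′} {x ∷ w} {x′ ∷ w′} (s≤s l) (s≤s l′) eq with ∷-injective eq
... | refl , eq′ with insertMin-injective l l′ eq′
... | refl , refl = refl , refl

insertMin-surjective : ∀ {x} → 0 ∈ x → Unique x → ∃₂ λ p w → x ≡ insertMin p w × p ≤ length w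
insertMin-surjective (here refl) (0∉t ∷ _) with unmap 0∉t
  where
  unmap : ∀ {t} → All (0 ≢_) t → ∃ λ w → map suc w ≡ t
  unmap [] = [] , refl
  unmap {zero ∷ t}  (0≢ ∷ _) = contradiction refl 0≢
  unmap {suc y ∷ t} (_ ∷ a) with unmap a
  ... | w , refl = y ∷ w , refl
... | w , refl = 0 , w , refl , z≤n
insertMin-surjective {zero ∷ t} (there 0∈) (0∉t ∷ _) = contradiction refl (All.lookup 0∉t 0∈)
insertMin-surjective {suc y ∷ t} (there 0∈) (_ ∷ u) with insertMin-surjective 0∈ u
... | p , w , refl , p≤ = suc p , y ∷ w , refl , s≤s p≤

-- `c` is the preceding letter of the run, or a sentinel at the start.
initialRun : ℕ → List ℕ → ℕ
initialRun c [] = 0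
initialRun c (x ∷ w) with x <? c
... | yes _ = suc (initialRun x w)
... | no _  = 0

run-≤-length : ∀ c w → initialRun c w ≤ length w
run-≤-length c [] = z≤n
run-≤-length c (x ∷ w) with x <? c
... | yes _ = s≤s (run-≤-length x w)
... | no _  = z≤n

-- The p letters before the new 0 still descend, and nothing lies below 0, so the run stops there.
run-insertMin : ∀ {p} c w → p ≤ initialRun c w → initialRun (suc c) (insertMin p w) ≡ suc p
run-insertMin {zero} c w _ = cong suc (run-0 (map suc w))
  where
  run-0 : ∀ w → initialRun 0 w ≡ 0
  run-0 [] = refl
  run-0 (x ∷ w) = refl
run-insertMin {suc p} c (x ∷ w) p≤ with x <? c
... | yes x<c with suc x <? suc c
...   | yes _ = cong suc (run-insertMin x w (s≤s⁻¹ p≤))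
...   | no x≮c = contradiction (s≤s x<c) x≮c

lrmins-≥-[] : ∀ {c w} → All (c ≤_) w → lrmins c w ≡ []
lrmins-≥-[] [] = refl
lrmins-≥-[] {w = x ∷ w} (c≤x ∷ a) = trans (lrmins-≥ w c≤x) (lrmins-≥-[] a)

-- Once the run breaks at some x > c, a later letter below c would complete 2-3-1 with c and x, so
-- no further minimum occurs.
#lrmins-run : ∀ {c w} → All (c ≢_) w → AllPairs (λ y z → ¬ R231 c y z) w → Unique w → Avoids R231 w → #lrmins c w ≡ initialRun c w
#lrmins-run [] _ _ _ = refl
#lrmins-run {c} {x ∷ w} (c≢x ∷ c∉w) (q ∷ _) (x∉w ∷ u) (p ∷ a) with x <? c
... | yes _  = cong suc (#lrmins-run x∉w p u a)
... | no x≮c = cong length (lrmins-≥-[] (All.map (λ h → ≮⇒≥ (λ z<c → h (z<c , ≤∧≢⇒< (≮⇒≥ x≮c) c≢x))) q))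

R231-bounded : ∀ {c w} → All (_< c) w → AllPairs (λ y z → ¬ R231 c y z) w
R231-bounded [] = []
R231-bounded (x<c ∷ b) = All.tabulate (λ _ (_ , c<x) → <-asym x<c c<x) ∷ R231-bounded b

#lrmins-231 : ∀ {w} → IsPermWord n w → Avoids R231 w → #lrmins n w ≡ initialRun n w
#lrmins-231 {n} pw a = #lrmins-run (All.map >⇒≢ (bounded pw))
  (R231-bounded (bounded pw)) (unique pw) a

-- The letters in front of the new 0 descend from c ≤ x, so none of them can be the 3 between x and
-- 0.
slot231-pairs : ∀ {p x} c {w} → c ≤ x → p ≤ initialRun c w → AllPairs (λ y z → ¬ R231 x y z) w →
  AllPairs (λ y z → ¬ R231 (suc x) y z) (insertMin p w)
slot231-pairs {zero} c c≤x _ q =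
  All.tabulate (λ _ ()) ∷ AllPairs.map⁺ (AllPairs.map (λ h (z<x , x<y) → h (s≤s⁻¹ z<x , s≤s⁻¹ x<y)) q)
slot231-pairs {suc p} c {a ∷ w} c≤x p≤ (_ ∷ q) with a <? c
... | yes a<c = All.tabulate (λ _ (_ , x<a) → <⇒≱ (s≤s⁻¹ x<a) (≤-trans (<⇒≤ a<c) c≤x))
  ∷ slot231-pairs a (≤-trans (<⇒≤ a<c) c≤x) (s≤s⁻¹ p≤) q

slot231 : ∀ {p} c {w} → p ≤ initialRun c w → Avoids R231 w → Avoids R231 (insertMin p w)
slot231 {zero} c {w} _ a = AllPairs-fromAll (λ _ ()) (All.universal-U (map suc w))
  ∷ Avoids-map⁺ suc (λ (p , q) → s≤s⁻¹ p , s≤s⁻¹ q) a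
slot231 {suc p} c {x ∷ w} p≤ (q ∷ a) with x <? c
... | yes _ = slot231-pairs x ≤-refl (s≤s⁻¹ p≤) q ∷ slot231 x (s≤s⁻¹ p≤) a

-- An ascent from c to x in front of the inserted 0 would make c, x, 0 a 2-3-1.
slot231⁻ : ∀ p {c w} → p ≤ length w → All (c ≢_) w → AllPairs (λ y z → ¬ R231 (suc c) y z) (insertMin p w) →
  Unique w → Avoids R231 (insertMin p w) → p ≤ initialRun c w
slot231⁻ zero _ _ _ _ _ = z≤n
slot231⁻ (suc p) {c} {x ∷ w} (s≤s p≤) (c≢x ∷ _) (h ∷ _) (x∉w ∷ u) (q ∷ a) with x <? c
... | yes _  = s≤s (slot231⁻ p p≤ x∉w q u a)
... | no x≮c = ⊥-elim (proj₁ (All-insertMin⁻ p w h) (z<s , s≤s (≤∧≢⇒< (≮⇒≥ x≮c) c≢x)))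

Avoids-insertMin⁻ : ∀ p w → Avoids R231 (insertMin p w) → Avoids R231 w
Avoids-insertMin⁻ zero    w       (_ ∷ a) = Avoids-map⁻ suc (λ (p , q) → s≤s p , s≤s q) a
Avoids-insertMin⁻ (suc p) []      _ = []
Avoids-insertMin⁻ (suc p) (x ∷ w) (q ∷ a) =
  AllPairs.map (λ h (z<x , x<y) → h (s≤s z<x , s≤s x<y)) (AllPairs-insertMin⁻ p w q) ∷ Avoids-insertMin⁻ p w a

tree231 : InsertionTree (avoids p231) #lrmins
tree231 = record
  { insert = insertMin
  ; slots = λ n w → downFrom (suc (initialRun n w))
  ; good-[] = refl
  ; stat-[] = refl
  ; slots-unique = λ {n} {w} _ → Unique.downFrom⁺ (suc (initialRun n w))
  ; insert-injective = λ {n} {_} {_} {w} {w′} _ _ p∈ p′∈ → insertMin-injective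
      (≤-trans (s≤s⁻¹ (∈-downFrom⁻ p∈)) (run-≤-length n w)) (≤-trans (s≤s⁻¹ (∈-downFrom⁻ p′∈)) (run-≤-length n w′))
  ; insert-sound = λ {_} {p} pw g p∈ → insertMin-permWord p pw
      , A231.Avoids⇒avoids (slot231 _ (s≤s⁻¹ (∈-downFrom⁻ p∈)) (A231.avoids⇒Avoids _ g))
  ; insert-complete = complete
  ; stat-insert = λ {n} {w} pw g → let a = A231.avoids⇒Avoids w g in trans
      (map-cong-local (All.tabulate (λ {p} p∈ → let p≤ = s≤s⁻¹ (∈-downFrom⁻ p∈) in
        trans (#lrmins-231 (insertMin-permWord p pw) (slot231 n p≤ a)) (run-insertMin n w p≤))))
      (cong (λ k → map suc (downFrom (suc k))) (sym (#lrmins-231 pw a)))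
  }
  where
  complete : ∀ {n x} → IsPermWord (suc n) x → T (avoids p231 x) →
      ∃₂ λ p w → x ≡ insertMin p w × IsPermWord n w × T (avoids p231 w) × p ∈ downFrom (suc (initialRun n w))
  complete {n} px g with insertMin-surjective (permWord-∈ px z<s) (unique px)
  ... | p , w , refl , p≤ = p , w , refl , pw , A231.Avoids⇒avoids (Avoids-insertMin⁻ p w a)
    , ∈-downFrom⁺ (s≤s (slot231⁻ p p≤ (All.map >⇒≢ (bounded pw)) (R231-bounded (bounded px)) (unique pw) a))
    where
    a = A231.avoids⇒Avoids _ g
    pw = insertMin-permWord⁻ p w px

-- Iterating a function until it reaches a given point

module _ {A : Set} (f : A → A) where

  -- The end point is left out of the list by each step but may also be its start: a cycle is a path
  -- from i to i.
  data Path : A → List A → A → Set where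
    stop : ∀ {z} → Path z [] z
    step : ∀ {x l z} → Path (f x) l z → Path x (x ∷ l) z

  path-deterministic : ∀ {x l l′ z} → Path x l z → Path x l′ z → z ∉ l → z ∉ l′ → l ≡ l′
  path-deterministic stop     stop      _   _    = refl
  path-deterministic stop     (step _)  _   z∉l′ = contradiction (here refl) z∉l′
  path-deterministic (step _) stop      z∉l _    = contradiction (here refl) z∉l
  path-deterministic (step p) (step p′) z∉l z∉l′ =
    cong (_ ∷_) (path-deterministic p p′ (z∉l ∘ there) (z∉l′ ∘ there))

  path-suffix : ∀ {x l z y} → Path x l z → y ∈ l → ∃ λ l′ → Path y l′ z × l′ ⊆ l × length l′ ≤ length l
  path-suffix (step p) (here refl) = _ , step p , (λ q → q) , ≤-refl
  path-suffix (step p) (there y∈l) with path-suffix p y∈l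
  ... | l′ , p′ , sub , len = l′ , p′ , there ∘ sub , m≤n⇒m≤1+n len

  -- If x recurred, the rest of the path from there would be a second path from x to z; determinism
  -- would make it equal to the whole, although it is shorter.
  path-unique : ∀ {x l z} → Path x l z → z ∉ l → Unique l
  path-unique stop _ = []
  path-unique {x} {_ ∷ l} (step p) z∉ = All.¬Any⇒All¬ l x∉l ∷ path-unique p (z∉ ∘ there)
    where
    x∉l : x ∉ l
    x∉l x∈l with path-suffix p x∈l
    ... | l′ , p′ , sub , len = contradiction len (<⇒≱ (≤-reflexive
      (cong length (path-deterministic (step p) p′ z∉ (z∉ ∘ there ∘ sub)))))

  path-closed : ∀ {x l z y} → Path x l z → y ∈ l → f y ∈ l ⊎ f y ≡ z
  path-closed (step stop)     (here refl) = inj₂ refl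
  path-closed (step (step _)) (here refl) = inj₁ (there (here refl))
  path-closed (step p)        (there y∈l) with path-closed p y∈l
  ... | inj₁ q = inj₁ (there q)
  ... | inj₂ q = inj₂ q

  path-end : ∀ {x l z} → Path x l z → ∃ λ k → iterate f x k ≡ z
  path-end stop = 0 , refl
  path-end (step p) with path-end p
  ... | k , eq = suc k , eq

  path-reaches : ∀ {x l z y} → Path x l z → y ∈ l → ∃ λ k → iterate f x k ≡ y
  path-reaches (step p) (here refl) = 0 , refl
  path-reaches (step p) (there y∈l) with path-reaches p y∈l
  ... | k , eq = suc k , eq

  iterate-+ : ∀ a b x → iterate f x (a + b) ≡ iterate f (iterate f x a) b
  iterate-+ zero    b x = refl
  iterate-+ (suc a) b x = iterate-+ a b (f x)

  iterate-injective : (∀ {x y} → f x ≡ f y → x ≡ y) → ∀ k {x y} → iterate f x k ≡ iterate f y k → x ≡ y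
  iterate-injective inj zero    eq = eq
  iterate-injective inj (suc k) eq = inj (iterate-injective inj k eq)

path-start : {f g : A → A} → ∀ {x y l z} → Path f x l z → Path g y l z → x ≡ y
path-start stop     stop     = refl
path-start (step _) (step _) = refl

-- The image of an entry is the start of the remaining path, which the remaining list and the end
-- point determine.
path-agree : {f g : A → A} → ∀ {x y l z u} → Path f x l z → Path g y l z → u ∈ l → f u ≡ g u
path-agree (step p) (step q) (here refl) = path-start p q
path-agree (step p) (step q) (there u∈l) = path-agree p q u∈l

-- Two of the n + 1 iterates from i on coincide, and injectivity cancels their common part. The
-- bound is what makes fuel n suffice in `orbitFrom`.
period : {f : Fin n → Fin n} → (∀ {x y} → f x ≡ f y → x ≡ y) → ∀ i → ∃ λ k → k < n × iterate f (f i) k ≡ i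
period {n} {f} inj i with pigeonhole (n<1+n n) (λ j → iterate f i (toℕ j))
... | a , b , a<b , eq with m≤n⇒∃[o]m+o≡n a<b
... | d , 1+a+d≡b = d , ≤-trans (≤-trans (m≤n+m (suc d) (toℕ a)) (≤-reflexive a+1+d≡b)) (s≤s⁻¹ (toℕ<n b))
  , sym (iterate-injective f inj (toℕ a) (trans eq (trans (cong (iterate f i) (trans (sym a+1+d≡b) (+-comm (toℕ a) (suc d))))
      (iterate-+ f (suc d) (toℕ a) i))))
  where a+1+d≡b = trans (+-suc (toℕ a) d) 1+a+d≡b

lrmins-++-≥ : ∀ {c l} r → All (c ≤_) l → lrmins c (l ++ r) ≡ lrmins c r
lrmins-++-≥ r [] = refl
lrmins-++-≥ {l = x ∷ l} r (c≤x ∷ a) = trans (lrmins-≥ (l ++ r) c≤x) (lrmins-++-≥ r a)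

-- P holds throughout the first block and fails where the next one opens, so it marks the cut.
++-split-injective : ∀ {P : A → Set} {l l′ r r′ : List A} → All P l → All P l′ →
  (∀ {h t} → r ≡ h ∷ t → ¬ P h) → (∀ {h t} → r′ ≡ h ∷ t → ¬ P h) → l ++ r ≡ l′ ++ r′ → l ≡ l′ × r ≡ r′
++-split-injective [] [] _ _ eq = refl , eq
++-split-injective [] (px ∷ _) ¬r _ eq = contradiction px (¬r eq)
++-split-injective (px ∷ _) [] _ ¬r′ eq = contradiction px (¬r′ (sym eq))
++-split-injective (_ ∷ a) (_ ∷ a′) ¬r ¬r′ eq with ∷-injective eq
... | refl , eq′ with ++-split-injective a a′ ¬r ¬r′ eq′
... | refl , r≡ = refl , r≡

minimum : (g : A → ℕ) (x : A) (xs : List A) → ∃ λ i → i ∈ x ∷ xs × All (λ y → g i ≤ g y) (x ∷ xs)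
minimum g x [] = x , here refl , ≤-refl ∷ []
minimum g x (y ∷ ys) with minimum g y ys
... | i , i∈ , i≤ with ≤-total (g x) (g i)
...   | inj₁ x≤i = x , here refl , ≤-refl ∷ All.map (≤-trans x≤i) i≤
...   | inj₂ i≤x = i , there i∈ , i≤x ∷ i≤

-- Cycles of a permutation

AllPairs-reverse : ∀ {R : A → A → Set} {xs} → AllPairs R xs → AllPairs (λ x y → R y x) (reverse xs)
AllPairs-reverse [] = []
AllPairs-reverse {R = R} {x ∷ xs} (p ∷ ps) = subst (AllPairs _) (sym (unfold-reverse x xs))
  (AllPairs.++⁺ (AllPairs-reverse ps) ([] ∷ []) (All.tabulate λ y∈ → All.lookup p (Any.reverse⁻ y∈) ∷ []))

module Cycles {n : ℕ} (π : Vec (Fin n) n) (inj : ∀ {x y} → app π x ≡ app π y → x ≡ y) where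

  f : Fin n → Fin n
  f = app π

  orbit-path : ∀ {i} fuel k x → k < fuel → iterate f x k ≡ i →
    ∃ λ l → orbitFrom π i fuel x ≡ map toℕ l × Path f x l i × i ∉ l
  orbit-path {i} (suc fuel) k x k<fuel eq with toℕ x ≡ᵇ toℕ i in x≡ᵇi
  ... | true rewrite toℕ-injective {i = x} {i} (≡ᵇ⇒≡ _ _ (subst T (sym x≡ᵇi) _)) = [] , refl , stop , λ ()
  orbit-path (suc fuel) zero x _ refl | false = contradiction (trans (sym x≡ᵇi) (≡ᵇ-refl (toℕ x))) λ ()
  orbit-path (suc fuel) (suc k) x (s≤s k<fuel) eq | false with orbit-path fuel k (f x) k<fuel eq
  ... | l , l≡ , p , i∉l = x ∷ l , cong (toℕ x ∷_) l≡ , step p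
    , λ { (here refl) → contradiction (trans (sym x≡ᵇi) (≡ᵇ-refl (toℕ x))) λ () ; (there i∈l) → i∉l i∈l }

  abstract
    orbit : ∀ i → ∃ λ l → orbitFrom π i n (f i) ≡ map toℕ l × Path f (f i) l i × i ∉ l
    orbit i with period inj i
    ... | k , k<n , eq = orbit-path n k (f i) k<n eq

  cycle : Fin n → List (Fin n)
  cycle i = i ∷ proj₁ (orbit i)

  cycleOf≡cycle : ∀ i → cycleOf π i ≡ map toℕ (cycle i)
  cycleOf≡cycle i = cong (toℕ i ∷_) (proj₁ (proj₂ (orbit i)))

  cycle-path : ∀ i → Path f i (cycle i) i
  cycle-path i = step (proj₁ (proj₂ (proj₂ (orbit i))))

  cycle-unique : ∀ i → Unique (cycle i)
  cycle-unique i with orbit i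
  ... | l , _ , p , i∉l = All.¬Any⇒All¬ l i∉l ∷ path-unique f p i∉l

  iterate-closed : ∀ {i y} k → y ∈ cycle i → iterate f y k ∈ cycle i
  iterate-closed zero y∈ = y∈
  iterate-closed {i} (suc k) y∈ with path-closed f (cycle-path i) y∈
  ... | inj₁ fy∈ = iterate-closed k fy∈
  ... | inj₂ fy≡i = iterate-closed k (here fy≡i)

  cycle-sym : ∀ {i j} → j ∈ cycle i → i ∈ cycle j
  cycle-sym {i} {j} j∈ with path-suffix f (cycle-path i) j∈
  ... | _ , p , _ with path-end f p
  ... | k , refl = iterate-closed {j} k (here refl)

  cycle-⊆ : ∀ {i j} → j ∈ cycle i → cycle j ⊆ cycle i
  cycle-⊆ {i} {j} j∈ y∈ with path-reaches f (cycle-path j) y∈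
  ... | k , refl = iterate-closed k j∈

  CycleMin : Fin n → Set
  CycleMin i = All (λ y → toℕ i ≤ toℕ y) (cycle i)

  isCycleMin⇒CycleMin : ∀ {i} → T (isCycleMin π i) → CycleMin i
  isCycleMin⇒CycleMin {i} t = All.map (λ {y} → ≤ᵇ⇒≤ (toℕ i) (toℕ y))
    (All.map⁻ (T-and⇒All _ (map toℕ (cycle i)) (subst (λ l → T (and (map (toℕ i ≤ᵇ_) l))) (cycleOf≡cycle i) t)))

  CycleMin⇒isCycleMin : ∀ {i} → CycleMin i → T (isCycleMin π i)
  CycleMin⇒isCycleMin {i} a = subst (λ l → T (and (map (toℕ i ≤ᵇ_) l))) (sym (cycleOf≡cycle i))
    (All⇒T-and _ (All.map⁺ (All.map ≤⇒≤ᵇ a)))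

  mins-CycleMin : All CycleMin (cycleMins π)
  mins-CycleMin = All.map isCycleMin⇒CycleMin (All.all-filter (T? ∘ isCycleMin π) (reverse (allFin n)))

  ∈-mins : ∀ {i} → CycleMin i → i ∈ cycleMins π
  ∈-mins {i} m = ∈-filter⁺ (T? ∘ isCycleMin π) (Any.reverse⁺ (∈-allFin i)) (CycleMin⇒isCycleMin m)

  Decreasing : List (Fin n) → Set
  Decreasing = AllPairs (λ i j → toℕ j < toℕ i)

  mins-decreasing : Decreasing (cycleMins π)
  mins-decreasing = AllPairs.filter⁺ (T? ∘ isCycleMin π) (AllPairs-reverse (AllPairs.tabulate⁺-< (λ i<j → i<j)))

  mins-unique : Unique (cycleMins π)
  mins-unique = AllPairs.map (λ j<i i≡j → <⇒≢ j<i (cong toℕ (sym i≡j))) mins-decreasing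

  cycles : List (Fin n)
  cycles = concatMap cycle (cycleMins π)

  Ψ≡cycles : Ψ π ≡ map toℕ cycles
  Ψ≡cycles = go (cycleMins π)
    where
    go : ∀ js → concatMap (cycleOf π) js ≡ map toℕ (concatMap cycle js)
    go [] = refl
    go (j ∷ js) = trans (cong₂ _++_ (cycleOf≡cycle j) (go js)) (sym (map-++ toℕ (cycle j) _))

  cycles-unique : Unique cycles
  cycles-unique = concatMap-unique cycle mins-unique (λ {i} _ → cycle-unique i)
    (λ i∈ j∈ → same-min (All.lookup mins-CycleMin i∈) (All.lookup mins-CycleMin j∈))
    where
    same-min : ∀ {i j y} → CycleMin i → CycleMin j → y ∈ cycle i → y ∈ cycle j → i ≡ j
    same-min {i} {j} mi mj y∈i y∈j = toℕ-injective
      (≤-antisym (All.lookup mi (cycle-⊆ y∈i (cycle-sym y∈j))) (All.lookup mj (cycle-⊆ y∈j (cycle-sym y∈i))))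

  ∈-min-cycle : ∀ x → ∃ λ i → i ∈ cycleMins π × x ∈ cycle i
  ∈-min-cycle x with minimum toℕ x (proj₁ (orbit x))
  ... | i , i∈ , i≤ = i , ∈-mins (All.tabulate (λ y∈ → All.lookup i≤ (cycle-⊆ i∈ y∈))) , cycle-sym i∈

  ∈-cycles : ∀ x → x ∈ cycles
  ∈-cycles x with ∈-min-cycle x
  ... | i , i∈ , x∈ = ∈-concatMap⁺ cycle (lose i∈ x∈)

  Ψ-permWord : IsPermWord n (Ψ π)
  Ψ-permWord = subst (IsPermWord n) (sym Ψ≡cycles) (permWord
    (Unique.map⁺ toℕ-injective cycles-unique)
    (All.map⁺ (All.universal toℕ<n cycles))
    (trans (length-map toℕ cycles) (trans
      (↭-length (unique-⇔⇒↭ (Unique.allFin⁺ n) cycles-unique (λ {x} _ → ∈-cycles x) (λ {x} _ → ∈-allFin x)))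
      (length-tabulate {n = n} (λ i → i)))))

  -- Each block opens with its minimum, which lies below all earlier minima, and the rest of the
  -- block stays above it.
  lrmins-cycles : ∀ c {js} → All CycleMin js → Decreasing js → All (λ j → toℕ j < c) js →
    lrmins c (map toℕ (concatMap cycle js)) ≡ map toℕ js
  lrmins-cycles c [] [] [] = refl
  lrmins-cycles c {j ∷ js} (m ∷ ms) (d ∷ ds) (j<c ∷ _) = trans
    (lrmins-< (map toℕ (proj₁ (orbit j) ++ concatMap cycle js)) j<c)
    (cong (toℕ j ∷_) (trans (cong (lrmins (toℕ j)) (map-++ toℕ (proj₁ (orbit j)) (concatMap cycle js)))
      (trans (lrmins-++-≥ _ (All.map⁺ (All.tail m))) (lrmins-cycles (toℕ j) ms ds d))))

  lrmins-Ψ : lrmins n (Ψ π) ≡ map toℕ (cycleMins π)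
  lrmins-Ψ = trans (cong (lrmins n) Ψ≡cycles)
    (lrmins-cycles n mins-CycleMin mins-decreasing (All.universal toℕ<n (cycleMins π)))

  #lrmins-Ψ : #lrmins n (Ψ π) ≡ numCycles π
  #lrmins-Ψ = trans (cong length lrmins-Ψ) (length-map toℕ (cycleMins π))

-- Recovering a permutation from its word

module _ {n : ℕ} {π ρ : Vec (Fin n) n}
  (injπ : ∀ {x y} → app π x ≡ app π y → x ≡ y) (injρ : ∀ {x y} → app ρ x ≡ app ρ y → x ≡ y) where

  private
    module P = Cycles π injπ
    module R = Cycles ρ injρ

  -- The entries of the block of j are at least j, and the next block opens with a smaller minimum,
  -- so both permutations cut the word at the same places.
  same-cycles : ∀ js → All P.CycleMin js → All R.CycleMin js → P.Decreasing js →
    concatMap P.cycle js ≡ concatMap R.cycle js → All (λ i → P.cycle i ≡ R.cycle i) js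
  same-cycles [] _ _ _ _ = []
  same-cycles (j ∷ js) (m ∷ ms) (m′ ∷ ms′) (d ∷ ds) eq
    with ++-split-injective m m′ (below P.cycle (λ _ → _ , refl) js d) (below R.cycle (λ _ → _ , refl) js d) eq
    where
    below : (cyc : Fin n → List (Fin n)) → (∀ i → ∃ λ l → cyc i ≡ i ∷ l) →
      ∀ js → All (λ i → toℕ i < toℕ j) js → ∀ {h t} → concatMap cyc js ≡ h ∷ t → ¬ toℕ j ≤ toℕ h
    below cyc start (i ∷ js) (i<j ∷ _) eq with cyc i | start i
    below cyc start (i ∷ js) (i<j ∷ _) refl | _ | _ , refl = <⇒≱ i<j
  ... | eq₁ , eq₂ = eq₁ ∷ same-cycles js ms ms′ ds eq₂

  -- The left-to-right minima recover the cycle minima, these recover the cuts, and the blocks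
  -- recover the images.
  Ψ-injective : Ψ π ≡ Ψ ρ → π ≡ ρ
  Ψ-injective eq = trans (sym (V.tabulate∘lookup π)) (trans (V.tabulate-cong agree) (V.tabulate∘lookup ρ))
    where
    mins≡ : cycleMins π ≡ cycleMins ρ
    mins≡ = map-injective toℕ-injective (trans (sym P.lrmins-Ψ) (trans (cong (lrmins n) eq) R.lrmins-Ψ))
    blocks : All (λ i → P.cycle i ≡ R.cycle i) (cycleMins π)
    blocks = same-cycles (cycleMins π) P.mins-CycleMin (subst (All R.CycleMin) (sym mins≡) R.mins-CycleMin) P.mins-decreasing
      (trans (map-injective toℕ-injective (trans (sym P.Ψ≡cycles) (trans eq R.Ψ≡cycles))) (cong (concatMap R.cycle) (sym mins≡)))
    agree : ∀ x → app π x ≡ app ρ x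
    agree x with P.∈-min-cycle x
    ... | i , i∈ , x∈ = path-agree (P.cycle-path i) (subst (λ l → Path (app ρ) i l i) (sym (All.lookup blocks i∈)) (R.cycle-path i)) x∈

lookup-injective : ∀ {k} {v : Vec A k} → Unique (toList v) → ∀ {i j} → lookup v i ≡ lookup v j → i ≡ j
lookup-injective _ {zero} {zero} _ = refl
lookup-injective {v = x V.∷ v} (x∉v ∷ _) {zero} {suc j} eq = contradiction eq (All.lookup x∉v (∈-toList⁺ (lookup-∈ j v)))
lookup-injective {v = x V.∷ v} (x∉v ∷ _) {suc i} {zero} eq = contradiction (sym eq) (All.lookup x∉v (∈-toList⁺ (lookup-∈ i v)))
lookup-injective {v = x V.∷ v} (_ ∷ u) {suc i} {suc j} eq = cong suc (lookup-injective u eq)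

app-injective : {π : Vec (Fin n) n} → π ∈ allPerms n → ∀ {x y} → app π x ≡ app π y → x ≡ y
app-injective π∈ = lookup-injective (Unique.map⁻ (unique (allPerms⇒permWord π∈)))

-- An injective self-map of a finite set is onto, so no inverse of Ψ has to be constructed.
Ψ-permutes : ∀ n → permWords n ↭ map Ψ (allPerms n)
Ψ-permutes n = unique-⊆-length⇒↭
  (map-unique Ψ (allPerms-unique n) (λ π∈ ρ∈ → Ψ-injective (app-injective π∈) (app-injective ρ∈)))
  sub (≤-reflexive (trans (length-map letters (allPerms n)) (sym (length-map Ψ (allPerms n)))))
  where
  sub : map Ψ (allPerms n) ⊆ permWords n
  sub w∈ with ∈-map⁻ Ψ w∈
  ... | π , π∈ , refl = permWord⇒permWords (Cycles.Ψ-permWord π (app-injective π∈))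

-- Transport along Ψ and comparison of the counts

countCycAvoid≡ : ∀ σ n m → countCycAvoid σ n m ≡ count (λ w → avoids σ w ∧ (#lrmins n w ≡ᵇ m)) (permWords n)
countCycAvoid≡ σ n m = trans
  (count-cong-∈ (allPerms n) (λ {π} π∈ → cong (λ k → avoids σ (Ψ π) ∧ (k ≡ᵇ m)) (sym (Cycles.#lrmins-Ψ π (app-injective π∈)))))
  (trans (sym (count-map Q Ψ (allPerms n))) (sym (count-↭ Q (Ψ-permutes n))))
  where
  Q : List ℕ → Bool
  Q w = avoids σ w ∧ (#lrmins n w ≡ᵇ m)

countCycAvoid≡countDyck : ∀ {σ} → InsertionTree (avoids σ) #lrmins → ∀ m i → countCycAvoid σ (m + i) m ≡ countDyck (m + i) m
countCycAvoid≡countDyck {σ} tree m i = trans (countCycAvoid≡ σ (m + i) m) (trans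
  (InsertionTree.count-stat tree (m + i) m) (trans (count-labels m i) (sym (countDyck≡ballot m i))))

countDyck-closed : ∀ p i → let m = suc p in
  (2 * (m + i) ∸ m) * countDyck (m + i) m ≡ m * ((2 * (m + i) ∸ m) C (m + i))
countDyck-closed p i = trans (cong₂ _*_ 2n∸m (countDyck≡ballot m i))
  (trans (ballot-closed p i) (cong (λ k → m * (k C (m + i))) (sym 2n∸m)))
  where
  m = suc p
  regroup : ∀ m i → 2 * (m + i) ≡ i + i + m + m
  regroup = solve-∀
  2n∸m : 2 * (m + i) ∸ m ≡ i + i + m
  2n∸m = trans (cong (_∸ m) (regroup m i)) (m+n∸n≡m (i + i + m) m)

mainTheorem14 : (n m : ℕ) → 1 ≤ n → 1 ≤ m → m ≤ n →
    (countCycAvoid p312 n m ≡ countDyck n m)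
    × (countCycAvoid p231 n m ≡ countDyck n m)
    × (countCycAvoid p213 n m ≡ countDyck n m)
    × ((2 * n ∸ m) * countDyck n m ≡ m * ((2 * n ∸ m) C n))
mainTheorem14 n m@(suc p) _ _ m≤n = at (countCycAvoid≡countDyck tree312 m i) , at (countCycAvoid≡countDyck tree231 m i)
  , at (countCycAvoid≡countDyck tree213 m i)
  , subst (λ n → (2 * n ∸ m) * countDyck n m ≡ m * ((2 * n ∸ m) C n)) m+i≡n (countDyck-closed p i)
  where
  i = n ∸ m
  m+i≡n : m + i ≡ n
  m+i≡n = m+[n∸m]≡n m≤n
  at : ∀ {σ} → countCycAvoid σ (m + i) m ≡ countDyck (m + i) m → countCycAvoid σ n m ≡ countDyck n m
  at {σ} = subst (λ n → countCycAvoid σ n m ≡ countDyck n m) m+i≡n
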